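{- Let $k$ be a positive integer and let $r > 0$ be a real number. Let $G$ be a graph with a rational-valued length-function $\ell : E(G) \to \mathbb{R}_{>0}$ (that is, $\ell(e) \in \mathbb{Q}$ for every $e \in E(G)$). Suppose $G$ contains an $\ell$-geodesic cycle $C$ with $\ell(C) \geq 2rk$ which is the $\mathbb{F}_2$-sum of cycles of $G$ of $\ell$-length at most $r$. Then the tree-width of $G$ is at least $k$.
   Context: Graphs are finite, simple and undirected. A length-function on a graph $G$ is a map $\ell : E(G) \to \mathbb{R}_{>0}$. The $\ell$-length $\ell(H)$ of a subgraph $H \subseteq G$ is $\sum_{e \in E(H)} \ell(e)$. For vertices $a,b$ of $G$, the distance $d_G^{\ell}(a,b)$ is the minimum $\ell$-length of a path in $G$ containing both $a$ and $b$ (infinite if there is none). A subgraph $H \subseteq G$ is $\ell$-geodesic if for any two vertices $a,b \in V(H)$ it contains a path between $a$ and $b$ of $\ell$-length $d_G^{\ell}(a,b)$. A cycle $C$ is the $\mathbb{F}_2$-sum of a set $\mathcal{D}$ of cycles, written $C = \bigoplus \mathcal{D}$, if $E(C)$ is precisely the set of edges of $G$ that lie in an odd number of elements of $\mathcal{D}$. -}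

module Defs where

open import Algebra.Properties.CommutativeMonoid.Sum using (sum)
open import Data.Bool.Base using (if_then_else_)
open import Data.Fin.Base as Fin using (Fin)
open import Data.Fin.Subset using (Subset; _∈_; _⊆_; ∣_∣)
open import Data.Fin.Subset.Properties using (_∈?_)
open import Data.Integer.Base using (+_)
open import Data.List.Base using (List; []; _∷_; length; filter)
open import Data.List.Membership.Propositional using () renaming (_∈_ to _∈ₗ_)
open import Data.List.Relation.Unary.Unique.Propositional using (Unique)
open import Data.Nat.Base as ℕ using (ℕ; NonZero; _∸_; _⊔_; _%_)
open import Data.Product using (∃; ∃-syntax; Σ-syntax; _×_; _,_)
open import Data.Rational.Base as ℚ using (ℚ; 0ℚ; 1ℚ; 1/_; Positive)
import Data.Rational.Properties as ℚₚ
open import Data.Sum.Base using (_⊎_; inj₁; inj₂)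
import Data.Vec.Functional as Vector
open import Function.Bundles using (_⇔_)
open import Relation.Binary.Definitions using (tri<; tri≈; tri>)
open import Relation.Binary.PropositionalEquality
  using (_≡_; refl; sym; trans; cong; subst)
open import Relation.Nullary using (¬_; does)

-- A real number is a two-sided Dedekind cut of ℚ: L q reads "q < x" and
-- U q reads "x < q".

record ℝ : Set₁ where
  field
    L U       : ℚ → Set
    L-inhab   : ∃ L
    U-inhab   : ∃ U
    L-down    : ∀ {p q} → p ℚ.< q → L q → L p
    U-up      : ∀ {p q} → p ℚ.< q → U p → U q
    L-open    : ∀ {p} → L p → ∃[ q ] p ℚ.< q × L q
    U-open    : ∀ {q} → U q → ∃[ p ] p ℚ.< q × U p
    disjoint  : ∀ {q} → ¬ (L q × U q)
    located   : ∀ {p q} → p ℚ.< q → L p ⊎ U q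

infix 4 _≤ᵣ_

_≤ᵣ_ : ℝ → ℝ → Set
x ≤ᵣ y = ∀ {q} → ℝ.L x q → ℝ.L y q

Positiveᵣ : ℝ → Set
Positiveᵣ x = ℝ.L x 0ℚ

fromℚ : ℚ → ℝ
fromℚ x = record
  { L        = ℚ._< x
  ; U        = x ℚ.<_
  ; L-inhab  = x ℚ.- 1ℚ , subst (x ℚ.- 1ℚ ℚ.<_) (ℚₚ.+-identityʳ x) (ℚₚ.+-monoʳ-< x (ℚₚ.negative⁻¹ (ℚ.- 1ℚ)))
  ; U-inhab  = x ℚ.+ 1ℚ , subst (ℚ._< x ℚ.+ 1ℚ) (ℚₚ.+-identityʳ x) (ℚₚ.+-monoʳ-< x (ℚₚ.positive⁻¹ 1ℚ))
  ; L-down   = ℚₚ.<-trans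
  ; U-up     = λ p<q x<p → ℚₚ.<-trans x<p p<q
  ; L-open   = λ p<x → let (q , p<q , q<x) = ℚₚ.<-dense p<x in q , p<q , q<x
  ; U-open   = λ x<q → let (p , x<p , p<q) = ℚₚ.<-dense x<q in p , p<q , x<p
  ; disjoint = λ (q<x , x<q) → ℚₚ.<-asym q<x x<q
  ; located  = loc
  }
  where
  loc : ∀ {p q} → p ℚ.< q → p ℚ.< x ⊎ x ℚ.< q
  loc {p} p<q with ℚₚ.<-cmp p x
  ... | tri< p<x _ _    = inj₁ p<x
  ... | tri≈ _ refl _   = inj₂ p<q
  ... | tri> _ _ x<p    = inj₂ (ℚₚ.<-trans x<p p<q)

-- The product of a real with a positive natural number:
-- q < n · x iff q / n < x.

infixr 7 _·_

_·_ : (n : ℕ) .{{_ : NonZero n}} → ℝ → ℝ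
n · x = record
  { L        = λ q → L (q ℚ.* c⁻¹)
  ; U        = λ q → U (q ℚ.* c⁻¹)
  ; L-inhab  = let (p , Lp) = L-inhab in p ℚ.* c , subst L (sym (cancel p)) Lp
  ; U-inhab  = let (p , Up) = U-inhab in p ℚ.* c , subst U (sym (cancel p)) Up
  ; L-down   = λ p<q → L-down (mono p<q)
  ; U-up     = λ p<q → U-up (mono p<q)
  ; L-open   = λ {p} Lp → let (q , p<q , Lq) = L-open Lp in
                 q ℚ.* c
               , subst (ℚ._< q ℚ.* c) (cancel′ p) (ℚₚ.*-monoˡ-<-pos c p<q)
               , subst L (sym (cancel q)) Lq
  ; U-open   = λ {q} Uq → let (p , p<q , Up) = U-open Uq in
                 p ℚ.* c
               , subst (p ℚ.* c ℚ.<_) (cancel′ q) (ℚₚ.*-monoˡ-<-pos c p<q)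
               , subst U (sym (cancel p)) Up
  ; disjoint = disjoint
  ; located  = λ p<q → located (mono p<q)
  }
  where
  open ℝ x
  c : ℚ
  c = + n ℚ./ 1
  instance
    c-pos : Positive c
    c-pos = ℚₚ.normalize-pos n 1
    c-nonZero : ℚ.NonZero c
    c-nonZero = ℚₚ.pos⇒nonZero c
  c⁻¹ : ℚ
  c⁻¹ = 1/ c
  instance
    c⁻¹-pos : Positive c⁻¹
    c⁻¹-pos = ℚₚ.1/pos⇒pos c
  mono : ∀ {p q} → p ℚ.< q → p ℚ.* c⁻¹ ℚ.< q ℚ.* c⁻¹
  mono = ℚₚ.*-monoˡ-<-pos c⁻¹
  cancel : ∀ p → (p ℚ.* c) ℚ.* c⁻¹ ≡ p
  cancel p = trans (ℚₚ.*-assoc p c c⁻¹)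
    (trans (cong (p ℚ.*_) (ℚₚ.*-inverseʳ c)) (ℚₚ.*-identityʳ p))
  cancel′ : ∀ p → (p ℚ.* c⁻¹) ℚ.* c ≡ p
  cancel′ p = trans (ℚₚ.*-assoc p c⁻¹ c)
    (trans (cong (p ℚ.*_) (ℚₚ.*-inverseˡ c)) (ℚₚ.*-identityʳ p))

-- A finite simple graph. An edge is an unordered pair of distinct vertices,
-- stored with its smaller end first; ends-injective excludes parallel edges.

record Graph : Set where
  field
    #V #E          : ℕ
    end₁ end₂      : Fin #E → Fin #V
    end₁<end₂      : ∀ e → end₁ e Fin.< end₂ e
    ends-injective : ∀ {e f} → end₁ e ≡ end₁ f → end₂ e ≡ end₂ f → e ≡ f

  V E : Set
  V = Fin #V
  E = Fin #E

  Joins : E → V → V → Set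
  Joins e u v = (end₁ e ≡ u × end₂ e ≡ v) ⊎ (end₁ e ≡ v × end₂ e ≡ u)

  data Walk : V → V → Set where
    [_]    : ∀ v → Walk v v
    _∷⟨_⟩_ : ∀ {u v w} (e : E) → Joins e u v → Walk v w → Walk u w

  vertices : ∀ {u v} → Walk u v → List V
  vertices [ v ]                = v ∷ []
  vertices (_∷⟨_⟩_ {u} _ _ w)   = u ∷ vertices w

  edges : ∀ {u v} → Walk u v → List E
  edges [ _ ]          = []
  edges (e ∷⟨ _ ⟩ w)   = e ∷ edges w

  -- The irrelevance of `closed` makes propositional equality of subgraphs
  -- equality of their vertex and edge sets.
  record Subgraph : Set where
    field
      VS      : Subset #V
      ES      : Subset #E
      .closed : ∀ {e} → e ∈ ES → end₁ e ∈ VS × end₂ e ∈ VS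

  open Subgraph public

  infix 4 _⊑_

  _⊑_ : Subgraph → Subgraph → Set
  H ⊑ K = VS H ⊆ VS K × ES H ⊆ ES K

  HasVertices : Subgraph → List V → Set
  HasVertices H vs = ∀ v → v ∈ VS H ⇔ v ∈ₗ vs

  HasEdges : Subgraph → List E → Set
  HasEdges H es = ∀ e → e ∈ ES H ⇔ e ∈ₗ es

  IsPathBetween : V → V → Subgraph → Set
  IsPathBetween a b P = Σ[ w ∈ Walk a b ]
    Unique (vertices w) × HasVertices P (vertices w) × HasEdges P (edges w)

  IsPath : Subgraph → Set
  IsPath P = ∃[ a ] ∃[ b ] IsPathBetween a b P

  -- A path on at least three vertices together with an edge joining its ends.
  IsCycle : Subgraph → Set
  IsCycle C = ∃[ a ] ∃[ b ] Σ[ w ∈ Walk a b ] Σ[ e ∈ E ]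
    Unique (vertices w) × 3 ℕ.≤ length (vertices w) × Joins e b a ×
    HasVertices C (vertices w) × HasEdges C (e ∷ edges w)

  multiplicity : List Subgraph → E → ℕ
  multiplicity 𝒟 e = length (filter (λ D → e ∈? ES D) 𝒟)

  IsF₂Sum : Subgraph → List Subgraph → Set
  IsF₂Sum C 𝒟 = ∀ e → e ∈ ES C ⇔ multiplicity 𝒟 e % 2 ≡ 1

  IsTree : Set
  IsTree = NonZero #V × (∀ s t → Walk s t) × ¬ ∃ IsCycle

record LengthFunction (G : Graph) : Set where
  open Graph G
  field
    ℓ          : E → ℚ
    ℓ-positive : ∀ e → 0ℚ ℚ.< ℓ e

  len : Subgraph → ℚ
  len H = sum ℚₚ.+-0-commutativeMonoid
    (λ e → if does (e ∈? ES H) then ℓ e else 0ℚ)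

  -- The distance between a and b is finite and equal to d.
  IsDistance : V → V → ℚ → Set
  IsDistance a b d =
    (∃[ P ] IsPath P × a ∈ VS P × b ∈ VS P × len P ≡ d) ×
    (∀ P → IsPath P → a ∈ VS P → b ∈ VS P → d ℚ.≤ len P)

  IsGeodesic : Subgraph → Set
  IsGeodesic H = ∀ {a b} → a ∈ VS H → b ∈ VS H →
    ∃[ P ] P ⊑ H × IsPathBetween a b P × IsDistance a b (len P)

record TreeDecomposition (G : Graph) : Set where
  open Graph G
  field
    T      : Graph
    isTree : Graph.IsTree T
  module T = Graph T
  field
    bag             : T.V → Subset #V
    covers-vertices : ∀ v → ∃[ t ] v ∈ bag t
    covers-edges    : ∀ e → ∃[ t ] end₁ e ∈ bag t × end₂ e ∈ bag t
    -- bag s ∩ bag t ⊆ bag u for every u on the s–t path in T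
    coherent        : ∀ {s t u v} (w : T.Walk s t) → Unique (T.vertices w) →
                      u ∈ₗ T.vertices w → v ∈ bag s → v ∈ bag t → v ∈ bag u

  width : ℕ
  width = Vector.foldr _⊔_ 0 (λ t → ∣ bag t ∣) ∸ 1

-- The tree-width, the minimum width of a tree-decomposition, is at least k.
TreeWidth≥ : Graph → ℕ → Set
TreeWidth≥ G k = (D : TreeDecomposition G) → k ℕ.≤ TreeDecomposition.width D

{-# OPTIONS --safe #-}
module Submission where

-- Let ρ = ℓ(C) / 2k, so that the cycles in 𝒟 have length at most ρ, and suppose
-- that a tree-decomposition has bags X = bag t of at most k vertices only. Call
-- two vertices of X adjacent if they lie on cycles of 𝒟 that meet; their distance
-- is then at most ρ. Closed depth-first tours of the components of this relation
-- take fewer than 2k steps in all. Replacing the stretches between successive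
-- visits to C by geodesics of C turns them into closed walks on C of total length
-- less than ℓ(C). These use every edge of C an even number of times, so they
-- leave a set R ⊆ E(C) with ℓ(R) > ℓ(C) / 2 unused.
--
-- Any two edges e, f of R lead into the same component K of G - X. Take a cut α
-- of C with coboundary {e, f}. It is constant on C ∩ Q for each component Q of
-- the adjacency relation, hence agrees on X ∩ C with a labelling γ of V that is
-- constant on each cycle of 𝒟 meeting X. The part of δγ supported on the edges
-- meeting K vanishes on each cycle of 𝒟, hence on C; but on C it has the same
-- sum as the corresponding part of δα, which would be 1 if only one of e, f met K.
--
-- So each node t of the tree has a neighbour in whose direction more than half
-- of C lies. Following these neighbours one finds two adjacent nodes pointing at
-- each other; their majorities share an edge of C, which is absurd.

open import Defs

open import Algebra.Bundles using (CommutativeMonoid; CommutativeRing)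
open import Data.Bool.Base using (Bool; true; false; if_then_else_; _∨_; _∧_; _xor_; not)
import Data.Bool.Properties as 𝔹ₚ
open import Data.Fin.Base using (Fin; zero; suc)
open import Data.Fin.Properties as Finₚ using (_≟_; any?)
open import Data.Fin.Subset using (Subset; _∈_; _∉_; _⊆_; _⊂_; ⁅_⁆; _∪_; ∣_∣) renaming (⊥ to ∅)
open import Data.Fin.Subset.Properties
  using (_∈?_; x∈p∪q⁻; x∈p∪q⁺; x∈⁅x⁆; x∈⁅y⁆⇒x≡y; ∉⊥; p⊆p∪q; p⊆q⇒∣p∣≤∣q∣; p⊂q⇒∣p∣<∣q∣)
open import Data.Integer.Base as ℤ using (+_)
import Data.Integer.Properties as ℤₚ
open import Data.List.Base using (List; []; _∷_; _++_; foldr; length)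
import Data.List.Membership.DecPropositional as DecMembership
open import Data.List.Membership.Propositional using (find; lose) renaming (_∈_ to _∈ₗ_)
open import Data.List.Membership.Propositional.Properties using (∈-++⁺ˡ; ∈-++⁺ʳ; ∈-++⁻)
open import Data.List.Relation.Binary.Sublist.Propositional as Sublist
  using ([]; _∷_; _∷ʳ_; ⊆-refl; ⊆-trans) renaming (_⊆_ to _⊆ₗ_)
open import Data.List.Relation.Unary.All as All using (All; []; _∷_)
open import Data.List.Relation.Unary.All.Properties using (¬Any⇒All¬; All¬⇒¬Any)
open import Data.List.Relation.Unary.AllPairs.Core using ([]; _∷_)
open import Data.List.Relation.Unary.Any as Any using (Any; here; there)
open import Data.List.Relation.Unary.Unique.Propositional using (Unique)
open import Data.Nat.Base as ℕ using (ℕ; s≤s; z≤n; _∸_; _%_; NonZero; _⊔_)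
import Data.Nat.Properties as ℕₚ
open import Data.Product using (∃-syntax; Σ-syntax; _×_; _,_; proj₁; proj₂)
open import Data.Rational.Base as ℚ using (ℚ; 0ℚ; 1ℚ; ½; 1/_)
import Data.Rational.Properties as ℚₚ
open import Data.Rational.Unnormalised.Base using (mkℚᵘ; *≡*)
import Data.Rational.Unnormalised.Properties as ℚᵘₚ
open import Data.Sum.Base as Sum using (_⊎_; inj₁; inj₂)
open import Data.Vec.Base using (tabulate)
open import Data.Vec.Properties using (lookup∘tabulate; []=⇒lookup; lookup⇒[]=)
import Data.Vec.Functional as Vector
open import Function.Base using (_∘_; id)
open import Function.Bundles using (Equivalence; _⇔_; mk⇔)
open import Level using (0ℓ)
open import Relation.Binary.PropositionalEquality
  using (_≡_; _≢_; refl; sym; trans; cong; cong₂; subst; subst₂; module ≡-Reasoning)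
open import Relation.Nullary using (¬_; Dec; yes; no; does; contradiction; _×-dec_; ¬?)
open import Relation.Nullary.Decidable as Dec using (dec-true; dec-false; does-⇔; decidable-stable)

open import Algebra.Properties.CommutativeSemigroup
  (CommutativeMonoid.commutativeSemigroup ℚₚ.+-0-commutativeMonoid)
  using () renaming (interchange to +-interchange; x∙yz≈y∙xz to x+[y+z]≡y+[x+z])
open import Algebra.Properties.Monoid.Mult ℚₚ.+-0-monoid using (×-homo-+) renaming (_×_ to _⊛_)

-- Finite sums in commutative monoids, over 𝔽₂ and over ℚ.

_∈ₗ?_ : ∀ {n} (i : Fin n) (is : List (Fin n)) → Dec (i ∈ₗ is)
_∈ₗ?_ = DecMembership._∈?_ _≟_

module Sums (M : CommutativeMonoid 0ℓ 0ℓ) where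
  open CommutativeMonoid M renaming (refl to ≈-refl; sym to ≈-sym; trans to ≈-trans)
  open import Algebra.Properties.CommutativeMonoid.Sum M public
  open import Algebra.Properties.CommutativeSemigroup commutativeSemigroup using (interchange)
  open import Relation.Binary.Reasoning.Setoid setoid

  Σₗ : ∀ {A : Set} → (A → Carrier) → List A → Carrier
  Σₗ f = foldr (λ x s → f x ∙ s) ε

  Σₗ-++ : ∀ {A : Set} (f : A → Carrier) xs ys → Σₗ f (xs ++ ys) ≈ Σₗ f xs ∙ Σₗ f ys
  Σₗ-++ f []       ys = ≈-sym (identityˡ _)
  Σₗ-++ f (x ∷ xs) ys = ≈-trans (∙-congˡ (Σₗ-++ f xs ys)) (≈-sym (assoc _ _ _))

  Σₗ-cong : ∀ {A : Set} {f g : A → Carrier} xs → (∀ {x} → x ∈ₗ xs → f x ≈ g x) → Σₗ f xs ≈ Σₗ g xs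
  Σₗ-cong []       f≈g = ≈-refl
  Σₗ-cong (x ∷ xs) f≈g = ∙-cong (f≈g (here refl)) (Σₗ-cong xs (f≈g ∘ there))

  Σₗ-∙ : ∀ {A : Set} (f g : A → Carrier) xs → Σₗ (λ x → f x ∙ g x) xs ≈ Σₗ f xs ∙ Σₗ g xs
  Σₗ-∙ f g []       = ≈-sym (identityˡ _)
  Σₗ-∙ f g (x ∷ xs) = ≈-trans (∙-congˡ (Σₗ-∙ f g xs)) (interchange _ _ _ _)

  Σₗ-ε : ∀ {A : Set} {f : A → Carrier} xs → (∀ {x} → x ∈ₗ xs → f x ≈ ε) → Σₗ f xs ≈ ε
  Σₗ-ε []       f≈ε = ≈-refl
  Σₗ-ε (x ∷ xs) f≈ε = ≈-trans (∙-cong (f≈ε (here refl)) (Σₗ-ε xs (f≈ε ∘ there))) (identityˡ _)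

  sum-ε : ∀ {n} {f : Fin n → Carrier} → (∀ i → f i ≈ ε) → sum f ≈ ε
  sum-ε {n} f≈ε = ≈-trans (sum-cong-≋ f≈ε) (sum-replicate-zero n)

  sum-Σₗ : ∀ {n} {A : Set} (f : Fin n → A → Carrier) xs →
    sum (λ i → Σₗ (f i) xs) ≈ Σₗ (λ x → sum (λ i → f i x)) xs
  sum-Σₗ {n} f []       = sum-ε {n} (λ _ → ≈-refl)
  sum-Σₗ {n} f (x ∷ xs) = ≈-trans (∑-distrib-+ {n} _ _) (∙-congˡ (sum-Σₗ f xs))

  sum-single : ∀ {n} (f : Fin n → Carrier) x →
    sum (λ i → if does (i ≟ x) then f i else ε) ≈ f x
  sum-single {ℕ.suc n} f zero = ≈-trans (∙-congˡ (sum-ε {n} (λ _ → ≈-refl))) (identityʳ _)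
  sum-single f (suc x)        = ≈-trans (identityˡ _) (sum-single (f ∘ suc) x)

  -- Exchange of the two summations: `f i` is counted once for each occurrence of `i`. This splits
  -- the length of a chain edge by edge.
  sum-occurrences : ∀ {n} (f : Fin n → Carrier) xs →
    sum (λ i → Σₗ (λ x → if does (i ≟ x) then f i else ε) xs) ≈ Σₗ f xs
  sum-occurrences {n} f xs = ≈-trans (sum-Σₗ {n} _ xs) (Σₗ-cong xs (λ {x} _ → sum-single f x))

  occurrences-unique : ∀ {n} {i : Fin n} c {xs} → Unique xs →
    Σₗ (λ x → if does (i ≟ x) then c else ε) xs ≈ (if does (i ∈ₗ? xs) then c else ε)
  occurrences-unique c [] = ≈-refl
  occurrences-unique {i = i} c {x ∷ xs} (x∉xs ∷ u) with i ≟ x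
  ... | no  _    = ≈-trans (identityˡ _) (occurrences-unique c u)
  ... | yes refl = ≈-trans (∙-congˡ (Σₗ-ε xs off)) (identityʳ c)
    where
    off : ∀ {y} → y ∈ₗ xs → (if does (i ≟ y) then c else ε) ≈ ε
    off {y} y∈ rewrite dec-false (i ≟ y) (All.lookup x∉xs y∈) = ≈-refl

  -- The bridge between sums over the edge set of a subgraph and sums along a walk that repeats no
  -- edge.
  sum-list : ∀ {n} (b : Fin n → Bool) (f : Fin n → Carrier) {xs} → Unique xs →
    (∀ i → b i ≡ does (i ∈ₗ? xs)) →
    sum (λ i → if b i then f i else ε) ≈ Σₗ f xs
  sum-list b f {xs} u b≡ = begin
    sum (λ i → if b i then f i else ε)
      ≈⟨ sum-cong-≋ (λ i → reflexive (cong (if_then f i else ε) (b≡ i))) ⟩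
    sum (λ i → if does (i ∈ₗ? xs) then f i else ε)
      ≈⟨ sum-cong-≋ (λ i → ≈-sym (occurrences-unique (f i) u)) ⟩
    sum (λ i → Σₗ (λ x → if does (i ≟ x) then f i else ε) xs)
      ≈⟨ sum-occurrences f xs ⟩
    Σₗ f xs ∎

xor-commutativeMonoid : CommutativeMonoid 0ℓ 0ℓ
xor-commutativeMonoid = record
  { Carrier             = Bool
  ; _≈_                 = _≡_
  ; _∙_                 = _xor_
  ; ε                   = false
  ; isCommutativeMonoid = CommutativeRing.+-isCommutativeMonoid 𝔹ₚ.xor-∧-commutativeRing
  }

open import Algebra.Properties.CommutativeSemigroup
  (CommutativeMonoid.commutativeSemigroup xor-commutativeMonoid)
  using () renaming (interchange to xor-interchange; x∙yz≈y∙xz to x⊕[y⊕z]≡y⊕[x⊕z])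

module F₂ = Sums xor-commutativeMonoid
module Q  = Sums ℚₚ.+-0-commutativeMonoid

sum-mono-≤ : ∀ {n} {f g : Fin n → ℚ} → (∀ i → f i ℚ.≤ g i) → Q.sum f ℚ.≤ Q.sum g
sum-mono-≤ {ℕ.zero}  f≤g = ℚₚ.≤-refl
sum-mono-≤ {ℕ.suc n} f≤g = ℚₚ.+-mono-≤ (f≤g zero) (sum-mono-≤ (f≤g ∘ suc))

Σₗ-nonneg : ∀ {A : Set} {f : A → ℚ} (xs : List A) → (∀ x → 0ℚ ℚ.≤ f x) → 0ℚ ℚ.≤ Q.Σₗ f xs
Σₗ-nonneg []       0≤f = ℚₚ.≤-refl
Σₗ-nonneg (x ∷ xs) 0≤f = ℚₚ.+-mono-≤ (0≤f x) (Σₗ-nonneg xs 0≤f)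

if-nonneg : ∀ b {c} → 0ℚ ℚ.≤ c → 0ℚ ℚ.≤ (if b then c else 0ℚ)
if-nonneg false _  = ℚₚ.≤-refl
if-nonneg true 0≤c = 0≤c

x≤x+y : ∀ {x y} → 0ℚ ℚ.≤ y → x ℚ.≤ x ℚ.+ y
x≤x+y {x} 0≤y = subst (ℚ._≤ x ℚ.+ _) (ℚₚ.+-identityʳ x) (ℚₚ.+-monoʳ-≤ x 0≤y)

x≤y+x : ∀ {x y} → 0ℚ ℚ.≤ y → x ℚ.≤ y ℚ.+ x
x≤y+x {x} {y} 0≤y = subst (x ℚ.≤_) (ℚₚ.+-comm x y) (x≤x+y 0≤y)

module _ {A : Set} (b : A → Bool) {c : ℚ} (0≤c : 0ℚ ℚ.≤ c) where
  private
    cost : List A → ℚ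
    cost = Q.Σₗ (λ x → if b x then c else 0ℚ)

    0≤cost : ∀ xs → 0ℚ ℚ.≤ cost xs
    0≤cost xs = Σₗ-nonneg xs (λ x → if-nonneg (b x) 0≤c)

  -- Applied with `b` the test for a fixed edge and `c` its length: an odd number of occurrences is
  -- at least one.
  odd⇒cost≥ : ∀ xs → F₂.Σₗ b xs ≡ true → c ℚ.≤ cost xs
  odd⇒cost≥ (x ∷ xs) odd with b x
  ... | true  = x≤x+y (0≤cost xs)
  ... | false = ℚₚ.≤-trans (odd⇒cost≥ xs odd) (x≤y+x ℚₚ.≤-refl)

  -- An even number of occurrences that is not zero is at least two.
  even⇒cost≥ : ∀ xs → F₂.Σₗ b xs ≡ false → ∀ {x} → x ∈ₗ xs → b x ≡ true → c ℚ.+ c ℚ.≤ cost xs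
  even⇒cost≥ (x ∷ xs) even x∈ bx with b x in eq
  even⇒cost≥ (x ∷ xs) even x∈          bx | true with F₂.Σₗ b xs in odd
  ... | true = ℚₚ.+-monoʳ-≤ c (odd⇒cost≥ xs odd)
  even⇒cost≥ (x ∷ xs) even (here refl) bx | false = contradiction (trans (sym eq) bx) λ ()
  even⇒cost≥ (x ∷ xs) even (there x∈)  bx | false =
    ℚₚ.≤-trans (even⇒cost≥ xs even x∈ bx) (x≤y+x ℚₚ.≤-refl)

fromList : ∀ {n} → List (Fin n) → Subset n
fromList = foldr (λ x S → ⁅ x ⁆ ∪ S) ∅

∈-fromList⁺ : ∀ {n} {x : Fin n} {xs} → x ∈ₗ xs → x ∈ fromList xs
∈-fromList⁺ (here refl) = x∈p∪q⁺ (inj₁ (x∈⁅x⁆ _))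
∈-fromList⁺ (there x∈)  = x∈p∪q⁺ (inj₂ (∈-fromList⁺ x∈))

∈-fromList⁻ : ∀ {n} {x : Fin n} xs → x ∈ fromList xs → x ∈ₗ xs
∈-fromList⁻ []       x∈ = contradiction x∈ ∉⊥
∈-fromList⁻ (y ∷ xs) x∈ with x∈p∪q⁻ ⁅ y ⁆ (fromList xs) x∈
... | inj₁ x∈y  = here (x∈⁅y⁆⇒x≡y y x∈y)
... | inj₂ x∈xs = there (∈-fromList⁻ xs x∈xs)

does-true : ∀ {A : Set} (a? : Dec A) → does a? ≡ true → A
does-true (yes a) _ = a

xor-cancel : ∀ x y z → (x xor y) xor (y xor z) ≡ x xor z
xor-cancel false false z = refl
xor-cancel false true  z = 𝔹ₚ.not-involutive z
xor-cancel true  false z = refl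
xor-cancel true  true  z = refl

xor≡false⇒≡ : ∀ {x y} → x xor y ≡ false → x ≡ y
xor≡false⇒≡ {false} {false} _ = refl
xor≡false⇒≡ {true}  {true}  _ = refl

-- Walks, cycles and cuts in a graph.

module Walks (G : Graph) where
  open Graph G

  Joins-sym : ∀ {e u v} → Joins e u v → Joins e v u
  Joins-sym (inj₁ j) = inj₂ j
  Joins-sym (inj₂ j) = inj₁ j

  Joins-irrefl : ∀ {e v} → ¬ Joins e v v
  Joins-irrefl {e} (inj₁ (p , q)) = Finₚ.<-irrefl (trans p (sym q)) (end₁<end₂ e)
  Joins-irrefl {e} (inj₂ (p , q)) = Finₚ.<-irrefl (trans p (sym q)) (end₁<end₂ e)

  Joins-other : ∀ {e u v w} → Joins e u v → Joins e u w → v ≡ w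
  Joins-other (inj₁ (_ , q)) (inj₁ (_ , q′)) = trans (sym q) q′
  Joins-other (inj₁ (p , q)) (inj₂ (p′ , q′)) = trans (trans (sym q) q′) (trans (sym p) p′)
  Joins-other (inj₂ (p , q)) (inj₁ (p′ , q′)) = trans (trans (sym p) p′) (trans (sym q) q′)
  Joins-other (inj₂ (p , _)) (inj₂ (p′ , _)) = trans (sym p) p′

  joins-ends : ∀ (P : V → Set) {e u v} → Joins e u v → P u → P v → P (end₁ e) × P (end₂ e)
  joins-ends P (inj₁ (refl , refl)) pu pv = pu , pv
  joins-ends P (inj₂ (refl , refl)) pu pv = pv , pu

  infixr 5 _⧺_

  _⧺_ : ∀ {u v w} → Walk u v → Walk v w → Walk u w
  [ _ ]         ⧺ q = q
  (e ∷⟨ j ⟩ p)  ⧺ q = e ∷⟨ j ⟩ (p ⧺ q)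

  edges-⧺ : ∀ {u v w} (p : Walk u v) (q : Walk v w) → edges (p ⧺ q) ≡ edges p ++ edges q
  edges-⧺ [ _ ]        q = refl
  edges-⧺ (e ∷⟨ j ⟩ p) q = cong (e ∷_) (edges-⧺ p q)

  ⧺-assoc : ∀ {u v w x} (p : Walk u v) (q : Walk v w) (r : Walk w x) → (p ⧺ q) ⧺ r ≡ p ⧺ (q ⧺ r)
  ⧺-assoc [ _ ]        q r = refl
  ⧺-assoc (e ∷⟨ j ⟩ p) q r = cong (e ∷⟨ j ⟩_) (⧺-assoc p q r)

  ∈-vertices-⧺ : ∀ {u v w x} (p : Walk u v) (q : Walk v w) →
    x ∈ₗ vertices (p ⧺ q) → x ∈ₗ vertices p ⊎ x ∈ₗ vertices q
  ∈-vertices-⧺ [ _ ]        q x∈          = inj₂ x∈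
  ∈-vertices-⧺ (e ∷⟨ j ⟩ p) q (here refl) = inj₁ (here refl)
  ∈-vertices-⧺ (e ∷⟨ j ⟩ p) q (there x∈)  = Sum.map₁ there (∈-vertices-⧺ p q x∈)

  ∈-vertices-⧺⁺ˡ : ∀ {u v w x} (p : Walk u v) (q : Walk v w) → x ∈ₗ vertices p → x ∈ₗ vertices (p ⧺ q)
  ∈-vertices-⧺⁺ˡ [ _ ]        [ _ ]        (here refl) = here refl
  ∈-vertices-⧺⁺ˡ [ _ ]        (_ ∷⟨ _ ⟩ _) (here refl) = here refl
  ∈-vertices-⧺⁺ˡ (e ∷⟨ j ⟩ p) q            (here refl) = here refl
  ∈-vertices-⧺⁺ˡ (e ∷⟨ j ⟩ p) q            (there x∈)  = there (∈-vertices-⧺⁺ˡ p q x∈)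

  ∈-vertices-⧺⁺ʳ : ∀ {u v w x} (p : Walk u v) (q : Walk v w) → x ∈ₗ vertices q → x ∈ₗ vertices (p ⧺ q)
  ∈-vertices-⧺⁺ʳ [ _ ]        q x∈ = x∈
  ∈-vertices-⧺⁺ʳ (e ∷⟨ j ⟩ p) q x∈ = there (∈-vertices-⧺⁺ʳ p q x∈)

  source∈ : ∀ {u v} (p : Walk u v) → u ∈ₗ vertices p
  source∈ [ _ ]        = here refl
  source∈ (_ ∷⟨ _ ⟩ _) = here refl

  target∈ : ∀ {u v} (p : Walk u v) → v ∈ₗ vertices p
  target∈ [ _ ]        = here refl
  target∈ (_ ∷⟨ _ ⟩ p) = there (target∈ p)

  rev : ∀ {u v} → Walk u v → Walk v u
  rev [ v ]                = [ v ]
  rev (_∷⟨_⟩_ {u} e j p)   = rev p ⧺ (e ∷⟨ Joins-sym j ⟩ [ u ])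

  ∈-vertices-rev : ∀ {u v x} (p : Walk u v) → x ∈ₗ vertices (rev p) → x ∈ₗ vertices p
  ∈-vertices-rev [ _ ]        x∈ = x∈
  ∈-vertices-rev (e ∷⟨ j ⟩ p) x∈ with ∈-vertices-⧺ (rev p) _ x∈
  ... | inj₁ x∈p                 = there (∈-vertices-rev p x∈p)
  ... | inj₂ (here refl)         = there (source∈ p)
  ... | inj₂ (there (here refl)) = here refl

  split : ∀ {u v x} (p : Walk u v) → x ∈ₗ vertices p →
    Σ[ q ∈ Walk u x ] Σ[ q′ ∈ Walk x v ] q ⧺ q′ ≡ p
  split [ v ]        (here refl) = [ v ] , [ v ] , refl
  split (e ∷⟨ j ⟩ p) (here refl) = [ _ ] , (e ∷⟨ j ⟩ p) , refl
  split (e ∷⟨ j ⟩ p) (there x∈)  = let (q , q′ , eq) = split p x∈ in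
    (e ∷⟨ j ⟩ q) , q′ , cong (e ∷⟨ j ⟩_) eq

  suffix : ∀ {u v x} (p : Walk u v) → x ∈ₗ vertices p → Σ[ q ∈ Walk x v ]
    vertices q ⊆ₗ vertices p × edges q ⊆ₗ edges p × (Unique (vertices p) → Unique (vertices q))
  suffix [ v ]          (here refl) = [ v ] , ⊆-refl , ⊆-refl , id
  suffix p@(_ ∷⟨ _ ⟩ _) (here refl) = p , ⊆-refl , ⊆-refl , id
  suffix (_ ∷⟨ _ ⟩ p)   (there x∈)  = let (q , vs , es , f) = suffix p x∈ in
    q , _ ∷ʳ vs , _ ∷ʳ es , λ { (_ ∷ u) → f u }

  toPath : ∀ {u v} (p : Walk u v) → Σ[ q ∈ Walk u v ]
    Unique (vertices q) × vertices q ⊆ₗ vertices p × edges q ⊆ₗ edges p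
  toPath [ v ]                 = [ v ] , [] ∷ [] , ⊆-refl , ⊆-refl
  toPath (_∷⟨_⟩_ {u} e j p) with toPath p
  ... | q , uq , vs , es with u ∈ₗ? vertices q
  ...   | no  u∉ = (e ∷⟨ j ⟩ q) , ¬Any⇒All¬ _ u∉ ∷ uq , refl ∷ vs , refl ∷ es
  -- `u` recurs on the path, so the loop back to `u` is dropped.
  ...   | yes u∈ = let (r , vs′ , es′ , f) = suffix q u∈ in
    r , f uq , u ∷ʳ ⊆-trans vs′ vs , e ∷ʳ ⊆-trans es′ es

  ends∈vertices : ∀ {u v e} (p : Walk u v) → e ∈ₗ edges p →
    end₁ e ∈ₗ vertices p × end₂ e ∈ₗ vertices p
  ends∈vertices (e ∷⟨ inj₁ (refl , refl) ⟩ p) (here refl) = here refl , there (source∈ p)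
  ends∈vertices (e ∷⟨ inj₂ (refl , refl) ⟩ p) (here refl) = there (source∈ p) , here refl
  ends∈vertices (e ∷⟨ j ⟩ p) (there f∈) = let (x , y) = ends∈vertices p f∈ in there x , there y

  joined∈vertices : ∀ {u v e x y} (p : Walk u v) → e ∈ₗ edges p → Joins e x y → x ∈ₗ vertices p
  joined∈vertices p e∈ (inj₁ (refl , refl)) = proj₁ (ends∈vertices p e∈)
  joined∈vertices p e∈ (inj₂ (refl , refl)) = proj₂ (ends∈vertices p e∈)

  unique-edges : ∀ {u v} (p : Walk u v) → Unique (vertices p) → Unique (edges p)
  unique-edges [ _ ]        _        = []
  unique-edges (e ∷⟨ j ⟩ p) (u∉ ∷ u) =
    ¬Any⇒All¬ _ (λ e∈ → All¬⇒¬Any u∉ (joined∈vertices p e∈ j)) ∷ unique-edges p u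

  joined-left : ∀ {e u v} → Joins e u v → end₁ e ≡ u ⊎ end₂ e ≡ u
  joined-left (inj₁ (p , _)) = inj₁ p
  joined-left (inj₂ (_ , q)) = inj₂ q

  incident-edge : ∀ {u v x} (p : Walk u v) → 2 ℕ.≤ length (vertices p) → x ∈ₗ vertices p →
    ∃[ e ] e ∈ₗ edges p × (end₁ e ≡ x ⊎ end₂ e ≡ x)
  incident-edge [ _ ] (s≤s ()) _
  incident-edge (e ∷⟨ j ⟩ _)     _ (here refl)         = e , here refl , joined-left j
  incident-edge (e ∷⟨ j ⟩ [ _ ]) _ (there (here refl)) = e , here refl , joined-left (Joins-sym j)
  incident-edge (_ ∷⟨ _ ⟩ p@(_ ∷⟨ _ ⟩ [ _ ])) _ (there x∈) =
    let (f , f∈ , i) = incident-edge p (s≤s (s≤s z≤n)) x∈ in f , there f∈ , i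
  incident-edge (_ ∷⟨ _ ⟩ p@(_ ∷⟨ _ ⟩ (_ ∷⟨ _ ⟩ _))) _ (there x∈) =
    let (f , f∈ , i) = incident-edge p (s≤s (s≤s z≤n)) x∈ in f , there f∈ , i

  -- An occurrence of `e` after the first edge would revisit `a`. As the first edge, `e` would make
  -- `b` the second vertex, and a path on at least three vertices would visit `b` again at its end.
  closing∉ : ∀ {a b e} (p : Walk a b) → Unique (vertices p) → 3 ℕ.≤ length (vertices p) →
    Joins e b a → ¬ e ∈ₗ edges p
  closing∉ (f ∷⟨ j ⟩ p) (a∉ ∷ u) 3≤ e-ba (there e∈) =
    All¬⇒¬Any a∉ (joined∈vertices p e∈ (Joins-sym e-ba))
  closing∉ (f ∷⟨ j ⟩ p) (a∉ ∷ u) 3≤ e-ba (here refl)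
    with Joins-other j (Joins-sym e-ba)
  closing∉ (f ∷⟨ j ⟩ [ _ ])         (a∉ ∷ u)       (s≤s (s≤s ())) e-ba (here refl) | refl
  closing∉ (f ∷⟨ j ⟩ (_ ∷⟨ _ ⟩ p))  (a∉ ∷ b∉ ∷ u)  3≤             e-ba (here refl) | refl =
    All¬⇒¬Any b∉ (target∈ p)

  -- The coboundary of a 0-cochain over 𝔽₂: the indicator of the cut between the two classes of `g`.
  δ : (V → Bool) → E → Bool
  δ g e = g (end₁ e) xor g (end₂ e)

  δ-joins : ∀ g {e u v} → Joins e u v → δ g e ≡ g u xor g v
  δ-joins g (inj₁ (refl , refl)) = refl
  δ-joins g {e} (inj₂ (refl , refl)) = 𝔹ₚ.xor-comm (g (end₁ e)) (g (end₂ e))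

  Σδ-walk : ∀ g {u v} (p : Walk u v) → F₂.Σₗ (δ g) (edges p) ≡ g u xor g v
  Σδ-walk g [ v ]                      = sym (𝔹ₚ.xor-same (g v))
  Σδ-walk g (_∷⟨_⟩_ {u} {v} {w} e j p) =
    trans (cong₂ _xor_ (δ-joins g j) (Σδ-walk g p)) (xor-cancel (g u) (g v) (g w))

  δ-walk≡ : ∀ g {u v x} (p : Walk u v) → (∀ {e} → e ∈ₗ edges p → δ g e ≡ false) →
    x ∈ₗ vertices p → g u ≡ g x
  δ-walk≡ g {x = x} p δ≡0 x∈ with split p x∈
  ... | q , q′ , refl = xor≡false⇒≡ (trans (sym (Σδ-walk g q)) (F₂.Σₗ-ε (edges q)
      (λ e∈ → δ≡0 (subst (_ ∈ₗ_) (sym (edges-⧺ q q′)) (∈-++⁺ˡ e∈)))))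

  -- The pairing of a 1-cochain with the edge set of `H`, seen as a 1-chain over 𝔽₂.
  ∮ : Subgraph → (E → Bool) → Bool
  ∮ H φ = F₂.sum (λ e → if does (e ∈? ES H) then φ e else false)

  char-edges : ∀ {H es} → HasEdges H es → ∀ e → does (e ∈? ES H) ≡ does (e ∈ₗ? es)
  char-edges {H} {es} he e = does-⇔ (he e) (e ∈? ES H) (e ∈ₗ? es)

  ∮-edges : ∀ {H es} φ → HasEdges H es → Unique es → ∮ H φ ≡ F₂.Σₗ φ es
  ∮-edges {H} φ he u = F₂.sum-list _ φ u (char-edges {H} he)

  module Cycle {H : Subgraph} (cycle : IsCycle H) where
    a b : V
    a = proj₁ cycle
    b = proj₁ (proj₂ cycle)
    path : Walk a b
    path = proj₁ (proj₂ (proj₂ cycle))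
    e₀ : E
    e₀ = proj₁ (proj₂ (proj₂ (proj₂ cycle)))
    private rest = proj₂ (proj₂ (proj₂ (proj₂ cycle)))
    path-unique : Unique (vertices path)
    path-unique = proj₁ rest
    long : 3 ℕ.≤ length (vertices path)
    long = proj₁ (proj₂ rest)
    e₀-joins : Joins e₀ b a
    e₀-joins = proj₁ (proj₂ (proj₂ rest))
    hasVertices : HasVertices H (vertices path)
    hasVertices = proj₁ (proj₂ (proj₂ (proj₂ rest)))
    hasEdges : HasEdges H (e₀ ∷ edges path)
    hasEdges = proj₂ (proj₂ (proj₂ (proj₂ rest)))

    edges-unique : Unique (e₀ ∷ edges path)
    edges-unique = ¬Any⇒All¬ _ (closing∉ path path-unique long e₀-joins) ∷ unique-edges path path-unique

    e₀∈ : e₀ ∈ ES H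
    e₀∈ = Equivalence.from (hasEdges e₀) (here refl)

    ends∈ : ∀ {e} → e ∈ ES H → end₁ e ∈ VS H × end₂ e ∈ VS H
    ends∈ {e} e∈ with Equivalence.to (hasEdges e) e∈
    ... | there e∈p  = let (x , y) = ends∈vertices path e∈p in
      Equivalence.from (hasVertices _) x , Equivalence.from (hasVertices _) y
    ... | here refl  = joins-ends (_∈ VS H) e₀-joins
      (Equivalence.from (hasVertices _) (target∈ path)) (Equivalence.from (hasVertices _) (source∈ path))

    -- The sum telescopes around the cycle, from `b` over `e₀` to `a` and along `path` back to `b`.
    ∮δ≡0 : ∀ g → ∮ H (δ g) ≡ false
    ∮δ≡0 g = begin
      ∮ H (δ g)                                ≡⟨ ∮-edges {H} (δ g) hasEdges edges-unique ⟩
      δ g e₀ xor F₂.Σₗ (δ g) (edges path)      ≡⟨ cong₂ _xor_ (δ-joins g e₀-joins) (Σδ-walk g path) ⟩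
      (g b xor g a) xor (g a xor g b)          ≡⟨ xor-cancel (g b) (g a) (g b) ⟩
      g b xor g b                              ≡⟨ 𝔹ₚ.xor-same (g b) ⟩
      false                                    ∎
      where open ≡-Reasoning


    incident : ∀ {v} → v ∈ VS H → ∃[ e ] e ∈ ES H × (end₁ e ≡ v ⊎ end₂ e ≡ v)
    incident {v} v∈ =
      let (e , e∈ , i) = incident-edge path (ℕₚ.≤-trans (ℕₚ.n≤1+n 2) long) (Equivalence.to (hasVertices v) v∈)
      in e , Equivalence.from (hasEdges e) (there e∈) , i

  -- Deleting `f` splits the path in two, and `α` marks the piece containing `a`. The values at the
  -- ends are recorded because the closing edge of a cycle joins them.
  cut-path : ∀ {a b f} (p : Walk a b) → Unique (vertices p) → f ∈ₗ edges p →
    ∃[ α ] α a ≡ true × α b ≡ false × (∀ {h} → h ∈ₗ edges p → δ α h ≡ does (h ≟ f))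
  cut-path {f = f} (_∷⟨_⟩_ {a} {v} {b} e j p) (a∉ ∷ u) f∈ with f ≟ e
  ... | yes refl = α , dec-true (a ≟ a) refl , off (target∈ p) , val
    where
    α : V → Bool
    α x = does (a ≟ x)
    off : ∀ {x} → x ∈ₗ vertices p → α x ≡ false
    off {x} x∈ = dec-false (a ≟ x) (All.lookup a∉ x∈)
    val : ∀ {h} → h ∈ₗ edges (e ∷⟨ j ⟩ p) → δ α h ≡ does (h ≟ e)
    val (here refl) = trans (δ-joins α j)
      (trans (cong₂ _xor_ (dec-true (a ≟ a) refl) (off (source∈ p))) (sym (dec-true (e ≟ e) refl)))
    val {h} (there h∈) = let (x , y) = ends∈vertices p h∈ in
      trans (cong₂ _xor_ (off x) (off y))
        (sym (dec-false (h ≟ e) λ { refl → All¬⇒¬Any a∉ (joined∈vertices p h∈ j) }))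
  cut-path {f = f} (_∷⟨_⟩_ {a} {v} {b} e j p) (a∉ ∷ u) (here f≡e) | no f≢e = contradiction f≡e f≢e
  cut-path {f = f} (_∷⟨_⟩_ {a} {v} {b} e j p) (a∉ ∷ u) (there f∈) | no f≢e
    with cut-path p u f∈
  ... | α′ , α′v , α′b , val′ = α , α-a , trans (same (target∈ p)) α′b , val
    where
    α : V → Bool
    α x = if does (a ≟ x) then true else α′ x
    α-a : α a ≡ true
    α-a rewrite dec-true (a ≟ a) refl = refl
    same : ∀ {x} → x ∈ₗ vertices p → α x ≡ α′ x
    same {x} x∈ rewrite dec-false (a ≟ x) (All.lookup a∉ x∈) = refl
    val : ∀ {h} → h ∈ₗ edges (e ∷⟨ j ⟩ p) → δ α h ≡ does (h ≟ f)
    val (here refl) = trans (δ-joins α j)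
      (trans (cong₂ _xor_ α-a (trans (same (source∈ p)) α′v)) (sym (dec-false (e ≟ f) (f≢e ∘ sym))))
    val (there h∈) = let (x , y) = ends∈vertices p h∈ in
      trans (cong₂ _xor_ (same x) (same y)) (val′ h∈)

  module _ {H : Subgraph} (cycle : IsCycle H) where
    open Cycle {H} cycle

    -- The cut from `cut-path` crosses `path` only in `f`; as it separates `a` from `b`, it also
    -- crosses the closing edge.
    cut-e₀ : ∀ {f} → f ∈ ES H →
      ∃[ α ] (∀ {h} → h ∈ ES H → δ α h ≡ does (h ≟ f) xor does (h ≟ e₀))
    cut-e₀ {f} f∈ with Equivalence.to (hasEdges f) f∈
    ... | here refl = (λ _ → false) , λ {h} _ → sym (𝔹ₚ.xor-same (does (h ≟ e₀)))
    ... | there f∈p with cut-path path path-unique f∈p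
    ...   | α , αa , αb , val = α , λ {h} h∈ → go h (Equivalence.to (hasEdges h) h∈)
      where
      e₀≢ : ∀ {h} → h ∈ₗ edges path → e₀ ≢ h
      e₀≢ h∈ refl = closing∉ path path-unique long e₀-joins h∈
      go : ∀ h → h ∈ₗ e₀ ∷ edges path → δ α h ≡ does (h ≟ f) xor does (h ≟ e₀)
      go h (here refl)
        rewrite δ-joins α e₀-joins | αa | αb
              | dec-false (e₀ ≟ f) (e₀≢ f∈p) | dec-true (e₀ ≟ e₀) refl = refl
      go h (there h∈) rewrite dec-false (h ≟ e₀) (e₀≢ h∈ ∘ sym) =
        trans (val h∈) (sym (𝔹ₚ.xor-identityʳ _))

    -- Two cuts through `e₀` are added, so that `e₀` cancels.
    cut : ∀ {f f′} → f ∈ ES H → f′ ∈ ES H →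
      ∃[ α ] (∀ {h} → h ∈ ES H → δ α h ≡ does (h ≟ f) xor does (h ≟ f′))
    cut {f} {f′} f∈ f′∈ with cut-e₀ f∈ | cut-e₀ f′∈
    ... | α , val | α′ , val′ = (λ v → α v xor α′ v) , λ {h} h∈ → begin
        (α (end₁ h) xor α′ (end₁ h)) xor (α (end₂ h) xor α′ (end₂ h))
          ≡⟨ xor-interchange (α (end₁ h)) _ _ _ ⟩
        δ α h xor δ α′ h
          ≡⟨ cong₂ _xor_ (val h∈) (val′ h∈) ⟩
        (does (h ≟ f) xor does (h ≟ e₀)) xor (does (h ≟ f′) xor does (h ≟ e₀))
          ≡⟨ cong ((does (h ≟ f) xor does (h ≟ e₀)) xor_) (𝔹ₚ.xor-comm (does (h ≟ f′)) _) ⟩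
        (does (h ≟ f) xor does (h ≟ e₀)) xor (does (h ≟ e₀) xor does (h ≟ f′))
          ≡⟨ xor-cancel (does (h ≟ f)) _ _ ⟩
        does (h ≟ f) xor does (h ≟ f′) ∎
      where
      open ≡-Reasoning

-- Lengths of walks, geodesics, and closed chains on a cycle.

module Lengths (G : Graph) (λG : LengthFunction G) where
  open Graph G
  open LengthFunction λG
  open Walks G

  0≤ℓ : ∀ e → 0ℚ ℚ.≤ ℓ e
  0≤ℓ e = ℚₚ.<⇒≤ (ℓ-positive e)

  ‖_‖ : ∀ {u v} → Walk u v → ℚ
  ‖ p ‖ = Q.Σₗ ℓ (edges p)

  ‖⧺‖ : ∀ {u v w} (p : Walk u v) (q : Walk v w) → ‖ p ⧺ q ‖ ≡ ‖ p ‖ ℚ.+ ‖ q ‖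
  ‖⧺‖ p q = trans (cong (Q.Σₗ ℓ) (edges-⧺ p q)) (Q.Σₗ-++ ℓ (edges p) (edges q))

  ‖rev‖ : ∀ {u v} (p : Walk u v) → ‖ rev p ‖ ≡ ‖ p ‖
  ‖rev‖ [ _ ]        = refl
  ‖rev‖ (e ∷⟨ j ⟩ p) = begin
    ‖ rev p ⧺ (e ∷⟨ Joins-sym j ⟩ [ _ ]) ‖   ≡⟨ ‖⧺‖ (rev p) _ ⟩
    ‖ rev p ‖ ℚ.+ (ℓ e ℚ.+ 0ℚ)               ≡⟨ cong₂ ℚ._+_ (‖rev‖ p) (ℚₚ.+-identityʳ (ℓ e)) ⟩
    ‖ p ‖ ℚ.+ ℓ e                            ≡⟨ ℚₚ.+-comm ‖ p ‖ (ℓ e) ⟩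
    ℓ e ℚ.+ ‖ p ‖                            ∎
    where open ≡-Reasoning

  Σₗ-sublist : ∀ {es fs} → es ⊆ₗ fs → Q.Σₗ ℓ es ℚ.≤ Q.Σₗ ℓ fs
  Σₗ-sublist []         = ℚₚ.≤-refl
  Σₗ-sublist (e ∷ʳ s)   = ℚₚ.≤-trans (Σₗ-sublist s) (x≤y+x (0≤ℓ e))
  Σₗ-sublist {e ∷ _} (refl ∷ s) = ℚₚ.+-monoʳ-≤ (ℓ e) (Σₗ-sublist s)

  weight : (E → Bool) → ℚ
  weight b = Q.sum (λ e → if b e then ℓ e else 0ℚ)

  weight-mono : ∀ {b c} → (∀ e → b e ≡ true → c e ≡ true) → weight b ℚ.≤ weight c
  weight-mono {b} {c} b⇒c = sum-mono-≤ go
    where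
    go : ∀ e → (if b e then ℓ e else 0ℚ) ℚ.≤ (if c e then ℓ e else 0ℚ)
    go e with b e in be
    ... | false = if-nonneg (c e) (0≤ℓ e)
    ... | true rewrite b⇒c e be = ℚₚ.≤-refl

  weight-single : ∀ e → weight (λ h → does (h ≟ e)) ≡ ℓ e
  weight-single e = Q.sum-single ℓ e

  ℓ≤len : ∀ H {e} → e ∈ ES H → ℓ e ℚ.≤ len H
  ℓ≤len H {e} e∈ = subst (ℚ._≤ len H) (weight-single e)
    (weight-mono λ h h≡e → dec-true (h ∈? ES H) (subst (_∈ ES H) (sym (does-true (h ≟ e) h≡e)) e∈))

  len-edges : ∀ H {es} → HasEdges H es → Unique es → len H ≡ Q.Σₗ ℓ es
  len-edges H he u = Q.sum-list _ ℓ u (char-edges {H} he)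

  walkSubgraph : ∀ {u v} → Walk u v → Subgraph
  walkSubgraph p = record
    { VS = fromList (vertices p)
    ; ES = fromList (edges p)
    ; closed = λ e∈ → let (x , y) = ends∈vertices p (∈-fromList⁻ (edges p) e∈) in
        ∈-fromList⁺ x , ∈-fromList⁺ y
    }

  -- Distances are minima over paths, so `p` is first pruned to a path, which is no longer than `p`;
  -- the path inside `C` is no longer than that.
  geodesic-walk : ∀ {C} → IsGeodesic C → ∀ {u v} → u ∈ VS C → v ∈ VS C → (p : Walk u v) →
    Σ[ q ∈ Walk u v ] (∀ {e} → e ∈ₗ edges q → e ∈ ES C) × ‖ q ‖ ℚ.≤ ‖ p ‖
  geodesic-walk geo u∈ v∈ p with toPath p | geo u∈ v∈
  ... | q , q-unique , _ , q⊆p | P , (_ , P⊆C) , (r , r-unique , _ , he) , (_ , minimal) =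
    r , (λ e∈ → P⊆C (Equivalence.from (he _) e∈)) , (begin
      ‖ r ‖                   ≡⟨ len-edges P he (unique-edges r r-unique) ⟨
      len P                   ≤⟨ minimal (walkSubgraph q) isPath (∈-fromList⁺ (source∈ q)) (∈-fromList⁺ (target∈ q)) ⟩
      len (walkSubgraph q)    ≡⟨ len-edges (walkSubgraph q) hasEdges-q (unique-edges q q-unique) ⟩
      ‖ q ‖                   ≤⟨ Σₗ-sublist q⊆p ⟩
      ‖ p ‖                   ∎)
    where
    open ℚₚ.≤-Reasoning
    hasEdges-q : HasEdges (walkSubgraph q) (edges q)
    hasEdges-q _ = mk⇔ (∈-fromList⁻ (edges q)) ∈-fromList⁺
    isPath : IsPath (walkSubgraph q)
    isPath = _ , _ , q , q-unique , (λ _ → mk⇔ (∈-fromList⁻ (vertices q)) ∈-fromList⁺) , hasEdges-q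

  module _ {H : Subgraph} (cycle : IsCycle H) where
    open Cycle {H} cycle

    len-cycle : len H ≡ ℓ e₀ ℚ.+ ‖ path ‖
    len-cycle = len-edges H hasEdges edges-unique

    -- Two vertices split the cycle into two arcs, and the shorter one is taken.
    half-cycle : ∀ {u v} → u ∈ VS H → v ∈ VS H → Σ[ p ∈ Walk u v ] ‖ p ‖ ℚ.+ ‖ p ‖ ℚ.≤ len H
    half-cycle {u} {v} u∈ v∈ = go (Equivalence.to (hasVertices u) u∈) (Equivalence.to (hasVertices v) v∈)
      where
      shorter : ∀ {x y} (p q : Walk x y) → ‖ p ‖ ℚ.+ ‖ q ‖ ≡ len H →
        Σ[ r ∈ Walk x y ] ‖ r ‖ ℚ.+ ‖ r ‖ ℚ.≤ len H
      shorter p q eq with ℚₚ.≤-total ‖ p ‖ ‖ q ‖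
      ... | inj₁ p≤q = p , subst (‖ p ‖ ℚ.+ ‖ p ‖ ℚ.≤_) eq (ℚₚ.+-monoʳ-≤ ‖ p ‖ p≤q)
      ... | inj₂ q≤p = q , subst (‖ q ‖ ℚ.+ ‖ q ‖ ℚ.≤_) eq (ℚₚ.+-monoˡ-≤ ‖ q ‖ q≤p)

      arcs : ∀ {x y} (p : Walk a x) (m : Walk x y) (q : Walk y b) → p ⧺ m ⧺ q ≡ path →
        Σ[ r ∈ Walk x y ] ‖ r ‖ ℚ.+ ‖ r ‖ ℚ.≤ len H
      -- The complementary arc runs back to `a`, over the closing edge to `b`, and back to `y`.
      arcs p m q eq = shorter m (rev p ⧺ (e₀ ∷⟨ Joins-sym e₀-joins ⟩ rev q)) (begin
        ‖ m ‖ ℚ.+ ‖ rev p ⧺ (e₀ ∷⟨ Joins-sym e₀-joins ⟩ rev q) ‖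
          ≡⟨ cong (‖ m ‖ ℚ.+_) (trans (‖⧺‖ (rev p) (e₀ ∷⟨ Joins-sym e₀-joins ⟩ rev q))
               (cong₂ (λ s t → s ℚ.+ (ℓ e₀ ℚ.+ t)) (‖rev‖ p) (‖rev‖ q))) ⟩
        ‖ m ‖ ℚ.+ (‖ p ‖ ℚ.+ (ℓ e₀ ℚ.+ ‖ q ‖))
          ≡⟨ reorder (‖ m ‖) (‖ p ‖) (ℓ e₀) (‖ q ‖) ⟩
        ℓ e₀ ℚ.+ (‖ p ‖ ℚ.+ (‖ m ‖ ℚ.+ ‖ q ‖))
          ≡⟨ cong (ℓ e₀ ℚ.+_) (trans (cong (‖ p ‖ ℚ.+_) (sym (‖⧺‖ m q)))
               (trans (sym (‖⧺‖ p (m ⧺ q))) (cong ‖_‖ eq))) ⟩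
        ℓ e₀ ℚ.+ ‖ path ‖
          ≡⟨ len-cycle ⟨
        len H ∎)
        where
        open ≡-Reasoning
        reorder : ∀ x y z w → x ℚ.+ (y ℚ.+ (z ℚ.+ w)) ≡ z ℚ.+ (y ℚ.+ (x ℚ.+ w))
        reorder x y z w = trans (cong (x ℚ.+_) (x+[y+z]≡y+[x+z] y z w))
          (trans (x+[y+z]≡y+[x+z] x z (y ℚ.+ w)) (cong (z ℚ.+_) (x+[y+z]≡y+[x+z] x y w)))

      go : u ∈ₗ vertices path → v ∈ₗ vertices path → Σ[ r ∈ Walk u v ] ‖ r ‖ ℚ.+ ‖ r ‖ ℚ.≤ len H
      go u∈p v∈p with split path u∈p
      ... | p , q , eq with ∈-vertices-⧺ p q (subst (λ w → v ∈ₗ vertices w) (sym eq) v∈p)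
      ...   | inj₂ v∈q with split q v∈q
      ...     | m , q′ , refl = arcs p m q′ eq
      -- Here `v` precedes `u` on `path`, so the arc is found from `v` to `u` and reversed.
      go u∈p v∈p | p , q , eq | inj₁ v∈′ with split p v∈′
      ...     | p′ , m , refl with arcs p′ m q (trans (sym (⧺-assoc p′ m q)) eq)
      ...       | r , r≤ = rev r , subst (λ x → x ℚ.+ x ℚ.≤ len H) (sym (‖rev‖ r)) r≤

    -- A closed F₂-chain on a cycle is constant, and it is zero if it is shorter
    -- than the cycle; then each edge that it uses is used at least twice.
    private
      occurs : E → E → Bool
      occurs h e = does (h ≟ e)

      parity : (es : List E) → (∀ {e} → e ∈ₗ es → e ∈ ES H) →
        (∀ g → F₂.Σₗ (δ g) es ≡ false) →
        ∀ {h} → h ∈ ES H → F₂.Σₗ (occurs h) es ≡ F₂.Σₗ (occurs e₀) es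
      parity es es⊆ closed {h} h∈ = xor≡false⇒≡ (trans (sym (F₂.Σₗ-∙ (occurs h) (occurs e₀) es))
        (trans (F₂.Σₗ-cong {f = λ e → occurs h e xor occurs e₀ e} {g = δ α} es pointwise) (closed α)))
        where
        ≟-sym : ∀ e f → does (e ≟ f) ≡ does (f ≟ e)
        ≟-sym e f = does-⇔ (mk⇔ sym sym) (e ≟ f) (f ≟ e)
        -- Pairing the closed chain with the cut through exactly `h` and `e₀` compares the parities
        -- of these two edges.
        α : V → Bool
        α = proj₁ (cut {H} cycle h∈ e₀∈)
        val : ∀ {f} → f ∈ ES H → δ α f ≡ does (f ≟ h) xor does (f ≟ e₀)
        val = proj₂ (cut {H} cycle h∈ e₀∈)
        pointwise : ∀ {e} → e ∈ₗ es → occurs h e xor occurs e₀ e ≡ δ α e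
        pointwise {e} e∈ = trans (cong₂ _xor_ (≟-sym h e) (≟-sym e₀ e)) (sym (val (es⊆ e∈)))

    uncovered : (es : List E) → (∀ {e} → e ∈ₗ es → e ∈ ES H) →
      (∀ g → F₂.Σₗ (δ g) es ≡ false) → Q.Σₗ ℓ es ℚ.< len H →
      let W = weight (λ h → does (h ∈? ES H) ∧ not (does (h ∈ₗ? es))) in
      len H ℚ.< W ℚ.+ W
    uncovered es es⊆ closed short = go (F₂.Σₗ (occurs e₀) es) refl
      where
      W U : ℚ
      W = weight (λ h → does (h ∈? ES H) ∧ not (does (h ∈ₗ? es)))
      U = weight (λ h → does (h ∈ₗ? es))
      cost : E → ℚ
      cost h = Q.Σₗ (λ e → if occurs h e then ℓ h else 0ℚ) es
      0≤cost : ∀ h → 0ℚ ℚ.≤ cost h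
      0≤cost h = Σₗ-nonneg es (λ e → if-nonneg (occurs h e) (0≤ℓ h))

      module _ (even : F₂.Σₗ (occurs e₀) es ≡ false) where
        twice : ∀ h → (if does (h ∈ₗ? es) then ℓ h else 0ℚ) ℚ.+ (if does (h ∈ₗ? es) then ℓ h else 0ℚ) ℚ.≤ cost h
        twice h with h ∈ₗ? es
        ... | no  _  = 0≤cost h
        ... | yes h∈ = even⇒cost≥ (occurs h) (0≤ℓ h) es (trans (parity es es⊆ closed (es⊆ h∈)) even) h∈
          (dec-true (h ≟ h) refl)

        U+U<len : U ℚ.+ U ℚ.< len H
        U+U<len = ℚₚ.≤-<-trans
          (subst₂ ℚ._≤_ (Q.∑-distrib-+ {#E} _ _) (Q.sum-occurrences ℓ es) (sum-mono-≤ twice)) short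

        len≤ : len H ℚ.≤ W ℚ.+ U
        len≤ = subst (len H ℚ.≤_) (Q.∑-distrib-+ {#E} _ _) (sum-mono-≤ step)
          where
          step : ∀ h → (if does (h ∈? ES H) then ℓ h else 0ℚ) ℚ.≤
            (if does (h ∈? ES H) ∧ not (does (h ∈ₗ? es)) then ℓ h else 0ℚ) ℚ.+ (if does (h ∈ₗ? es) then ℓ h else 0ℚ)
          step h with does (h ∈? ES H) | does (h ∈ₗ? es)
          ... | true  | true  = x≤y+x ℚₚ.≤-refl
          ... | true  | false = x≤x+y ℚₚ.≤-refl
          ... | false | true  = x≤x+y {0ℚ} (0≤ℓ h)
          ... | false | false = ℚₚ.≤-refl

      go : ∀ b → F₂.Σₗ (occurs e₀) es ≡ b → len H ℚ.< W ℚ.+ W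
      -- Every edge of the cycle is used an odd number of times, so the chain would be at least as
      -- long as the cycle.
      go true odd = contradiction (ℚₚ.≤-<-trans len≤Σ short) (ℚₚ.<-irrefl refl)
        where
        below : ∀ h → (if does (h ∈? ES H) then ℓ h else 0ℚ) ℚ.≤ cost h
        below h with h ∈? ES H
        ... | no  _  = 0≤cost h
        ... | yes h∈ = odd⇒cost≥ (occurs h) (0≤ℓ h) es (trans (parity es es⊆ closed h∈) odd)
        len≤Σ : len H ℚ.≤ Q.Σₗ ℓ es
        len≤Σ = subst (len H ℚ.≤_) (Q.sum-occurrences ℓ es) (sum-mono-≤ below)
      -- Used edges occur at least twice, whence `U + U < len H`. Together with `len H ≤ W + U` this
      -- leaves more than half of the cycle for `W`.
      go false even with len H ℚₚ.<? W ℚ.+ W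
      ... | yes L<  = L<
      ... | no  L≮  = contradiction (begin-strict
        len H ℚ.+ len H             ≤⟨ ℚₚ.+-mono-≤ (len≤ even) (len≤ even) ⟩
        (W ℚ.+ U) ℚ.+ (W ℚ.+ U)     ≡⟨ +-interchange W U W U ⟩
        (W ℚ.+ W) ℚ.+ (U ℚ.+ U)     <⟨ ℚₚ.+-mono-≤-< (ℚₚ.≮⇒≥ L≮) (U+U<len even) ⟩
        len H ℚ.+ len H             ∎) (ℚₚ.<-irrefl refl)
        where
        open ℚₚ.≤-Reasoning

-- Depth-first tours through `X` and their projections to `C`.

⊛-monoˡ-≤ : ∀ {ρ m n} → 0ℚ ℚ.≤ ρ → m ℕ.≤ n → m ⊛ ρ ℚ.≤ n ⊛ ρ
⊛-monoˡ-≤ {n = ℕ.zero}  0≤ρ z≤n       = ℚₚ.≤-refl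
⊛-monoˡ-≤ {n = ℕ.suc n} 0≤ρ z≤n       = ℚₚ.+-mono-≤ 0≤ρ (⊛-monoˡ-≤ {n = n} 0≤ρ z≤n)
⊛-monoˡ-≤ {ρ}           0≤ρ (s≤s m≤n) = ℚₚ.+-monoʳ-≤ ρ (⊛-monoˡ-≤ 0≤ρ m≤n)

∣p∣<∣p∪x∣ : ∀ {n} {p : Subset n} {x} → x ∉ p → ∣ p ∣ ℕ.< ∣ p ∪ ⁅ x ⁆ ∣
∣p∣<∣p∪x∣ {x = x} x∉p = p⊂q⇒∣p∣<∣q∣ (p⊆p∪q ⁅ x ⁆ , x , x∈p∪q⁺ (inj₂ (x∈⁅x⁆ x)) , x∉p)

∪-⊆ : ∀ {n} {p q : Subset n} {x} → p ⊆ q → x ∈ q → p ∪ ⁅ x ⁆ ⊆ q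
∪-⊆ {p = p} {x = x} p⊆q x∈q y∈ with x∈p∪q⁻ p ⁅ x ⁆ y∈
... | inj₁ y∈p = p⊆q y∈p
... | inj₂ y∈x = subst (_∈ _) (sym (x∈⁅y⁆⇒x≡y x y∈x)) x∈q

double-< : ∀ {m n} → m ℕ.< n → 2 ℕ.+ (m ℕ.+ m) ℕ.≤ n ℕ.+ n
double-< {m} {n} m<n = subst (ℕ._≤ n ℕ.+ n) (cong ℕ.suc (ℕₚ.+-suc m m)) (ℕₚ.+-mono-≤ m<n m<n)

module Tours (G : Graph) (λG : LengthFunction G)
  {C : Graph.Subgraph G} (geodesic : LengthFunction.IsGeodesic λG C)
  (X : Subset (Graph.#V G)) {ρ : ℚ} (0≤ρ : 0ℚ ℚ.≤ ρ)
  (Adj : Graph.V G → Graph.V G → Set) (Adj? : ∀ x y → Dec (Adj x y))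
  (Adj-sym : ∀ {x y} → Adj x y → Adj y x)
  (Adj-walk : ∀ {x y} → Adj x y → Σ[ p ∈ Graph.Walk G x y ] Lengths.‖_‖ G λG p ℚ.≤ ρ)
  where
  open Graph G
  open LengthFunction λG
  open Walks G
  open Lengths G λG

  data Route : V → V → Set where
    stop : ∀ x → Route x x
    step : ∀ {x y z} → Adj x y → Route y z → Route x z

  stops : ∀ {x z} → Route x z → List V
  stops (stop x)       = x ∷ []
  stops (step {x} _ p) = x ∷ stops p

  steps : ∀ {x z} → Route x z → ℕ
  steps (stop _)   = 0
  steps (step _ p) = ℕ.suc (steps p)

  -- A visit to `y` is replaced by `y`, `w`, `y`.
  detour : ∀ {x y z w} (p : Route x z) → y ∈ₗ stops p → Adj y w →
    Σ[ q ∈ Route x z ] steps q ≡ 2 ℕ.+ steps p × (∀ {v} → v ∈ₗ stops p → v ∈ₗ stops q) × w ∈ₗ stops q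
  detour (stop _)   (here refl) a = step a (step (Adj-sym a) (stop _)) , refl , there ∘ there , there (here refl)
  detour (step b p) (here refl) a =
    step a (step (Adj-sym a) (step b p)) , refl , there ∘ there , there (here refl)
  detour (step b p) (there y∈)  a = let (q , n , old , new) = detour p y∈ a in
    step b q , cong ℕ.suc n , (λ { (here refl) → here refl ; (there v∈) → there (old v∈) }) , there new

  -- Induction along the route. `w` is the walk made since `a`, the last stop on `C`; it is pending
  -- until the route returns to `C`, and is then replaced by a geodesic of `C`.
  project : ∀ {a x z} → a ∈ VS C → z ∈ VS C → (w : Walk a x) (p : Route x z) →
    Σ[ q ∈ Walk a z ] (∀ {e} → e ∈ₗ edges q → e ∈ ES C) × ‖ q ‖ ℚ.≤ ‖ w ‖ ℚ.+ steps p ⊛ ρ ×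
      (∀ {y} → y ∈ₗ stops p → y ∈ VS C → y ∈ₗ vertices q)
  project a∈ z∈ w (stop z) = let (q , q⊆ , q≤) = geodesic-walk {C} geodesic a∈ z∈ w in
    q , q⊆ , ℚₚ.≤-trans q≤ (ℚₚ.≤-reflexive (sym (ℚₚ.+-identityʳ ‖ w ‖))) , λ { (here refl) _ → target∈ q }
  project {x = x} a∈ z∈ w (step b p) with x ∈? VS C
  ... | no x∉ =
    let (r , r≤) = Adj-walk b
        (q , q⊆ , q≤ , visits) = project a∈ z∈ (w ⧺ r) p
    in q , q⊆ , (begin
      ‖ q ‖                                        ≤⟨ q≤ ⟩
      ‖ w ⧺ r ‖ ℚ.+ steps p ⊛ ρ                    ≡⟨ cong (ℚ._+ steps p ⊛ ρ) (‖⧺‖ w r) ⟩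
      (‖ w ‖ ℚ.+ ‖ r ‖) ℚ.+ steps p ⊛ ρ            ≡⟨ ℚₚ.+-assoc ‖ w ‖ ‖ r ‖ (steps p ⊛ ρ) ⟩
      ‖ w ‖ ℚ.+ (‖ r ‖ ℚ.+ steps p ⊛ ρ)            ≤⟨ ℚₚ.+-monoʳ-≤ ‖ w ‖ (ℚₚ.+-monoˡ-≤ (steps p ⊛ ρ) r≤) ⟩
      ‖ w ‖ ℚ.+ (ρ ℚ.+ steps p ⊛ ρ)                ∎)
      , λ { (here refl) x∈ → contradiction x∈ x∉ ; (there y∈) → visits y∈ }
    where open ℚₚ.≤-Reasoning
  -- The pending walk is replaced by `q′` inside `C`, and a new one starts at `x` with `r`.
  ... | yes x∈ =
    let (r , r≤) = Adj-walk b
        (q , q⊆ , q≤ , visits) = project x∈ z∈ r p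
        (q′ , q′⊆ , q′≤) = geodesic-walk {C} geodesic a∈ x∈ w
    in q′ ⧺ q
     , (λ e∈ → Sum.[ q′⊆ , q⊆ ] (∈-++⁻ (edges q′) (subst (_ ∈ₗ_) (edges-⧺ q′ q) e∈)))
     , (begin
      ‖ q′ ⧺ q ‖                                   ≡⟨ ‖⧺‖ q′ q ⟩
      ‖ q′ ‖ ℚ.+ ‖ q ‖                             ≤⟨ ℚₚ.+-mono-≤ q′≤ q≤ ⟩
      ‖ w ‖ ℚ.+ (‖ r ‖ ℚ.+ steps p ⊛ ρ)            ≤⟨ ℚₚ.+-monoʳ-≤ ‖ w ‖ (ℚₚ.+-monoˡ-≤ (steps p ⊛ ρ) r≤) ⟩
      ‖ w ‖ ℚ.+ (ρ ℚ.+ steps p ⊛ ρ)                ∎)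
      , λ { (here refl) _ → ∈-vertices-⧺⁺ˡ q′ q (target∈ q′)
          ; (there y∈) y∈C → ∈-vertices-⧺⁺ʳ q′ q (visits y∈ y∈C) }
    where open ℚₚ.≤-Reasoning

  Closed : Subset #V → Set
  Closed S = ∀ {x y} → x ∈ S → y ∈ X → Adj x y → y ∈ S

  -- Depth-first search: each vertex added to the tour costs two steps.
  record Tour (S : Subset #V) (c : V) : Set where
    field
      S′      : Subset #V
      route   : Route c c
      S⊆S′    : S ⊆ S′
      S′⊆X    : S′ ⊆ X
      c∈S′    : c ∈ S′
      visited : ∀ {x} → x ∈ S′ → x ∈ S ⊎ x ∈ₗ stops route
      -- The starting vertex adds two on the right but costs no step, which makes room for the extra
      -- `2`.
      size    : (2 ℕ.+ steps route) ℕ.+ (∣ S ∣ ℕ.+ ∣ S ∣) ℕ.≤ ∣ S′ ∣ ℕ.+ ∣ S′ ∣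

  -- As long as some `y` in `X` outside `S′` is adjacent to a vertex of `S′`, a detour to `y`
  -- enlarges the tour. `fuel` bounds the number of vertices of `X` that are left.
  complete : ∀ {S c} → Closed S → (fuel : ℕ) (t : Tour S c) → ∣ X ∣ ℕ.≤ fuel ℕ.+ ∣ Tour.S′ t ∣ →
    Σ[ t ∈ Tour S c ] Closed (Tour.S′ t)
  complete {S} {c} S-closed fuel t X≤ with any? (λ x → any? (λ y →
    (x ∈? Tour.S′ t) ×-dec (y ∈? X) ×-dec ¬? (y ∈? Tour.S′ t) ×-dec Adj? x y))
  ... | no none = t , λ {x} {y} x∈ y∈ a → decidable-stable (y ∈? Tour.S′ t) (λ y∉ → none (x , y , x∈ , y∈ , y∉ , a))
  complete {S} {c} S-closed fuel t X≤ | yes (x , y , x∈ , y∈ , y∉ , a) = continue fuel X≤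
    where
    open Tour t
    x∈route : x ∈ₗ stops route
    x∈route with visited x∈
    -- `S` is closed, so an `x` in `S` would already have brought `y` into `S`.
    ... | inj₁ x∈S = contradiction (S⊆S′ (S-closed x∈S y∈ a)) y∉
    ... | inj₂ x∈r = x∈r
    bigger : ∣ S′ ∣ ℕ.< ∣ S′ ∪ ⁅ y ⁆ ∣
    bigger = ∣p∣<∣p∪x∣ y∉
    t′ : Tour S c
    t′ = let (q , n , old , new) = detour route x∈route a in record
      { S′      = S′ ∪ ⁅ y ⁆
      ; route   = q
      ; S⊆S′    = p⊆p∪q ⁅ y ⁆ ∘ S⊆S′
      ; S′⊆X    = ∪-⊆ S′⊆X y∈
      ; c∈S′    = p⊆p∪q ⁅ y ⁆ c∈S′
      ; visited = λ z∈ → Sum.[ Sum.map₂ old ∘ visited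
                             , (λ z∈y → inj₂ (subst (_∈ₗ stops q) (sym (x∈⁅y⁆⇒x≡y y z∈y)) new)) ]
                           (x∈p∪q⁻ S′ ⁅ y ⁆ z∈)
      ; size    = ℕₚ.≤-trans (subst (λ m → 2 ℕ.+ m ℕ.+ (∣ S ∣ ℕ.+ ∣ S ∣) ℕ.≤ 2 ℕ.+ (∣ S′ ∣ ℕ.+ ∣ S′ ∣)) (sym n)
                    (s≤s (s≤s size))) (double-< bigger)
      }
    continue : (fuel : ℕ) → ∣ X ∣ ℕ.≤ fuel ℕ.+ ∣ S′ ∣ → Σ[ t ∈ Tour S c ] Closed (Tour.S′ t)
    continue ℕ.zero       X≤ = contradiction
      (ℕₚ.<-≤-trans bigger (ℕₚ.≤-trans (p⊆q⇒∣p∣≤∣q∣ (Tour.S′⊆X t′)) X≤)) (ℕₚ.<-irrefl refl)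
    continue (ℕ.suc fuel) X≤ = complete S-closed fuel t′
      (ℕₚ.≤-trans X≤ (subst (ℕ._≤ fuel ℕ.+ ∣ S′ ∪ ⁅ y ⁆ ∣) (ℕₚ.+-suc fuel _) (ℕₚ.+-monoʳ-≤ fuel bigger)))

  tour : ∀ {S c} → S ⊆ X → Closed S → c ∈ X → c ∉ S → Σ[ t ∈ Tour S c ] Closed (Tour.S′ t)
  tour {S} {c} S⊆X S-closed c∈X c∉S = complete S-closed ∣ X ∣ start (ℕₚ.m≤m+n ∣ X ∣ _)
    where
    start : Tour S c
    start = record
      { S′      = S ∪ ⁅ c ⁆
      ; route   = stop c
      ; S⊆S′    = p⊆p∪q ⁅ c ⁆
      ; S′⊆X    = ∪-⊆ S⊆X c∈X
      ; c∈S′    = x∈p∪q⁺ (inj₂ (x∈⁅x⁆ c))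
      ; visited = λ x∈ → Sum.map₂ (λ x∈c → here (x∈⁅y⁆⇒x≡y c x∈c)) (x∈p∪q⁻ S ⁅ c ⁆ x∈)
      ; size    = double-< (∣p∣<∣p∪x∣ c∉S)
      }

  -- Edges of C (with multiplicity) such that a labelling of V which is constant
  -- along them agrees on C ∩ S with one that is constant on the Adj-components.
  record Cover (S : Subset #V) : Set where
    field
      S⊆X    : S ⊆ X
      adj-closed : Closed S
      chain  : List E
      chain⊆ : ∀ {e} → e ∈ₗ chain → e ∈ ES C
      cycle  : ∀ g → F₂.Σₗ (δ g) chain ≡ false
      n      : ℕ
      -- Truncation admits the empty cover. For nonempty `S` two steps are saved, which later makes
      -- the length bound strict.
      n≤     : n ℕ.≤ (∣ S ∣ ℕ.+ ∣ S ∣) ∸ 2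
      cost   : Q.Σₗ ℓ chain ℚ.≤ n ⊛ ρ
      extend : ∀ α → (∀ {e} → e ∈ₗ chain → δ α e ≡ false) → Σ[ β ∈ (V → Bool) ]
                 (∀ {x} → x ∈ S → x ∈ VS C → β x ≡ α x) ×
                 (∀ {x y} → x ∈ X → y ∈ X → Adj x y → β x ≡ β y)

  -- The projected tour is a closed walk on `C`, so every coboundary sums to zero along it and it
  -- may be appended to the chain.
  add-tour : ∀ {S c} → Cover S → c ∈ VS C → (t : Tour S c) → Closed (Tour.S′ t) → Cover (Tour.S′ t)
  add-tour {S} {c} cover c∈C t S′-closed = record
    { S⊆X    = S′⊆X
    ; adj-closed = S′-closed
    ; chain  = edges q ++ chain
    ; chain⊆ = λ e∈ → Sum.[ q⊆ , chain⊆ ] (∈-++⁻ (edges q) e∈)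
    ; cycle  = λ g → trans (F₂.Σₗ-++ (δ g) (edges q) chain)
                 (cong₂ _xor_ (trans (Σδ-walk g q) (𝔹ₚ.xor-same (g c))) (cycle g))
    ; n      = steps route ℕ.+ n
    ; n≤     = n≤′
    ; cost   = begin
        Q.Σₗ ℓ (edges q ++ chain)         ≡⟨ Q.Σₗ-++ ℓ (edges q) chain ⟩
        ‖ q ‖ ℚ.+ Q.Σₗ ℓ chain            ≤⟨ ℚₚ.+-mono-≤ q≤ cost ⟩
        (0ℚ ℚ.+ steps route ⊛ ρ) ℚ.+ n ⊛ ρ ≡⟨ cong (ℚ._+ n ⊛ ρ) (ℚₚ.+-identityˡ (steps route ⊛ ρ)) ⟩
        steps route ⊛ ρ ℚ.+ n ⊛ ρ         ≡⟨ ×-homo-+ ρ (steps route) n ⟨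
        (steps route ℕ.+ n) ⊛ ρ           ∎
    ; extend = extend′
    }
    where
    open Tour t
    open Cover cover
    open ℚₚ.≤-Reasoning
    projected : Σ[ q ∈ Walk c c ] (∀ {e} → e ∈ₗ edges q → e ∈ ES C) × ‖ q ‖ ℚ.≤ 0ℚ ℚ.+ steps route ⊛ ρ ×
      (∀ {y} → y ∈ₗ stops route → y ∈ VS C → y ∈ₗ vertices q)
    projected = project c∈C c∈C [ c ] route
    q  = proj₁ projected
    q⊆ = proj₁ (proj₂ projected)
    q≤ = proj₁ (proj₂ (proj₂ projected))

    n≤′ : steps route ℕ.+ n ℕ.≤ (∣ S′ ∣ ℕ.+ ∣ S′ ∣) ∸ 2
    -- The saving of two from the earlier tours is discarded, since the new tour supplies its own.
    n≤′ = ℕₚ.≤-trans (ℕₚ.+-monoʳ-≤ (steps route) (ℕₚ.≤-trans n≤ (ℕₚ.m∸n≤m _ 2)))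
      (ℕₚ.∸-monoˡ-≤ 2 size)

    extend′ : ∀ α → (∀ {e} → e ∈ₗ edges q ++ chain → δ α e ≡ false) → Σ[ β ∈ (V → Bool) ]
      (∀ {x} → x ∈ S′ → x ∈ VS C → β x ≡ α x) ×
      (∀ {x y} → x ∈ X → y ∈ X → Adj x y → β x ≡ β y)
    extend′ α δα≡0 with extend α (δα≡0 ∘ ∈-++⁺ʳ (edges q))
    ... | β , agrees , constant = β′ , agrees′ , constant′
      where
      β′ : V → Bool
      -- `S` and `S′` are both closed, so all new vertices may share the value at `c`. The value
      -- outside `S′` is arbitrary.
      β′ x = if does (x ∈? S) then β x else if does (x ∈? S′) then α c else false
      agrees′ : ∀ {x} → x ∈ S′ → x ∈ VS C → β′ x ≡ α x
      agrees′ {x} x∈S′ x∈C with x ∈? S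
      ... | yes x∈S = agrees x∈S x∈C
      ... | no  x∉S rewrite dec-true (x ∈? S′) x∈S′ with visited x∈S′
      ...   | inj₁ x∈S = contradiction x∈S x∉S
      -- `α` is constant along `q`, which starts at `c` and passes through every stop on `C`.
      ...   | inj₂ x∈r = δ-walk≡ α q (δα≡0 ∘ ∈-++⁺ˡ) (proj₂ (proj₂ (proj₂ projected)) x∈r x∈C)
      same : ∀ {S} → Closed S → ∀ {x y} → x ∈ X → y ∈ X → Adj x y → does (x ∈? S) ≡ does (y ∈? S)
      same {S} S-closed {x} {y} x∈ y∈ a =
        does-⇔ (mk⇔ (λ x∈S → S-closed x∈S y∈ a) (λ y∈S → S-closed y∈S x∈ (Adj-sym a))) (x ∈? S) (y ∈? S)
      constant′ : ∀ {x y} → x ∈ X → y ∈ X → Adj x y → β′ x ≡ β′ y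
      constant′ x∈ y∈ a
        rewrite same adj-closed x∈ y∈ a | same S′-closed x∈ y∈ a | constant x∈ y∈ a = refl

  -- Each new tour starts at a vertex of `X` on `C` that is still missing, so that its projection
  -- begins and ends on `C`.
  cover-all : (fuel : ℕ) → ∀ {S} → Cover S → ∣ X ∣ ℕ.≤ fuel ℕ.+ ∣ S ∣ →
    Σ[ S ∈ Subset #V ] Cover S × (∀ {x} → x ∈ X → x ∈ VS C → x ∈ S)
  cover-all fuel {S} cover X≤ with any? (λ c → (c ∈? X) ×-dec (c ∈? VS C) ×-dec ¬? (c ∈? S))
  ... | no none = S , cover , λ {x} x∈X x∈C → decidable-stable (x ∈? S) (λ x∉S → none (x , x∈X , x∈C , x∉S))
  ... | yes (c , c∈X , c∈C , c∉S) with tour (Cover.S⊆X cover) (Cover.adj-closed cover) c∈X c∉S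
  ...   | t , S′-closed = continue fuel X≤
    where
    open Tour t
    bigger : ∣ S ∣ ℕ.< ∣ S′ ∣
    bigger = p⊂q⇒∣p∣<∣q∣ (S⊆S′ , c , c∈S′ , c∉S)
    continue : (fuel : ℕ) → ∣ X ∣ ℕ.≤ fuel ℕ.+ ∣ S ∣ →
      Σ[ S ∈ Subset #V ] Cover S × (∀ {x} → x ∈ X → x ∈ VS C → x ∈ S)
    continue ℕ.zero       X≤ = contradiction
      (ℕₚ.<-≤-trans bigger (ℕₚ.≤-trans (p⊆q⇒∣p∣≤∣q∣ S′⊆X) X≤)) (ℕₚ.<-irrefl refl)
    continue (ℕ.suc fuel) X≤ = cover-all fuel (add-tour cover c∈C t S′-closed)
      (ℕₚ.≤-trans X≤ (subst (ℕ._≤ fuel ℕ.+ ∣ S′ ∣) (ℕₚ.+-suc fuel _) (ℕₚ.+-monoʳ-≤ fuel bigger)))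

  cover : Σ[ S ∈ Subset #V ] Cover S × (∀ {x} → x ∈ X → x ∈ VS C → x ∈ S)
  cover = cover-all ∣ X ∣ empty (ℕₚ.m≤m+n ∣ X ∣ _)
    where
    empty : Cover ∅
    empty = record
      { S⊆X    = λ x∈ → contradiction x∈ ∉⊥
      ; adj-closed = λ x∈ → contradiction x∈ ∉⊥
      ; chain  = []
      ; chain⊆ = λ ()
      ; cycle  = λ _ → refl
      ; n      = 0
      ; n≤     = z≤n
      ; cost   = ℚₚ.≤-refl
      ; extend = λ α _ → (λ _ → false) , (λ x∈ → contradiction x∈ ∉⊥) , (λ _ _ _ → refl)
      }

⊛-monoˡ-< : ∀ {ρ m n} → 0ℚ ℚ.< ρ → m ℕ.< n → m ⊛ ρ ℚ.< n ⊛ ρ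
⊛-monoˡ-< {ρ} {m} {n} 0<ρ m<n = ℚₚ.<-≤-trans
  (subst (ℚ._< ρ ℚ.+ m ⊛ ρ) (ℚₚ.+-identityˡ (m ⊛ ρ)) (ℚₚ.+-monoˡ-< (m ⊛ ρ) 0<ρ))
  (⊛-monoˡ-≤ (ℚₚ.<⇒≤ 0<ρ) m<n)

-- Parities, and pairings with 𝔽₂-sums of cycles.

xorSum-true : ∀ {A : Set} (b : A → Bool) xs → F₂.Σₗ b xs ≡ true → ∃[ x ] x ∈ₗ xs × b x ≡ true
xorSum-true b (x ∷ xs) odd with b x in bx
... | true  = x , here refl , bx
... | false = let (y , y∈ , by) = xorSum-true b xs odd in y , there y∈ , by

odd : ℕ → Bool
odd ℕ.zero    = false
odd (ℕ.suc n) = not (odd n)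

odd⇔%2 : ∀ n → odd n ≡ true ⇔ n % 2 ≡ 1
odd⇔%2 0 = mk⇔ (λ ()) (λ ())
odd⇔%2 1 = mk⇔ (λ _ → refl) (λ _ → refl)
odd⇔%2 (ℕ.suc (ℕ.suc n)) = subst (λ b → b ≡ true ⇔ n % 2 ≡ 1) (sym (𝔹ₚ.not-involutive (odd n))) (odd⇔%2 n)

-- Here x, y and s, t are the values of two labellings at the ends of an edge, and
-- a, b the indicators of a set at these ends.
transfer-left : ∀ b s t y → b ∧ (s xor t) ≡ (b ∧ (s xor y)) xor (b ∧ (y xor t))
transfer-left false s t y = refl
transfer-left true  s t y = sym (xor-cancel s y t)

transfer-right : ∀ a s t x → (a ∨ false) ∧ (s xor t) ≡ ((a ∨ false) ∧ (x xor t)) xor ((a ∧ (x xor s)) xor false)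
transfer-right false s     t     x     = refl
transfer-right true  false false false = refl
transfer-right true  false false true  = refl
transfer-right true  false true  false = refl
transfer-right true  false true  true  = refl
transfer-right true  true  false false = refl
transfer-right true  true  false true  = refl
transfer-right true  true  true  false = refl
transfer-right true  true  true  true  = refl

transfer-both : ∀ a s t x y →
  (a ∨ a) ∧ (s xor t) ≡ ((a ∨ a) ∧ (x xor y)) xor ((a ∧ (x xor s)) xor (a ∧ (y xor t)))
transfer-both false s t x y = refl
transfer-both true  s t x y = begin
  s xor t                                      ≡⟨ xor-cancel s x t ⟨
  (s xor x) xor (x xor t)                      ≡⟨ cong₂ _xor_ (𝔹ₚ.xor-comm s x) (sym (xor-cancel x y t)) ⟩
  (x xor s) xor ((x xor y) xor (y xor t))      ≡⟨ x⊕[y⊕z]≡y⊕[x⊕z] (x xor s) (x xor y) (y xor t) ⟩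
  (x xor y) xor ((x xor s) xor (y xor t))      ∎
  where
  open ≡-Reasoning

-- Used with `α` for `s`, `t` and `γ` for `x`, `y`: on the edges meeting a set, the two coboundaries
-- differ by another coboundary, provided that edges leaving the set end outside it in a vertex
-- where the labellings agree.
transfer : ∀ {a b s t x y} → (a ≡ false × x ≡ s) ⊎ (b ≡ false × y ≡ t) ⊎ a ≡ b →
  (a ∨ b) ∧ (s xor t) ≡ ((a ∨ b) ∧ (x xor y)) xor ((a ∧ (x xor s)) xor (b ∧ (y xor t)))
transfer {b = b} {s} {t} {y = y} (inj₁ (refl , refl))        = transfer-left b s t y
transfer {a} {s = s} {t} {x}     (inj₂ (inj₁ (refl , refl))) = transfer-right a s t x
transfer {a} {s = s} {t} {x} {y} (inj₂ (inj₂ refl))          = transfer-both a s t x y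

module F₂Sums (G : Graph) where
  open Graph G
  open Walks G

  char-sum : ∀ {C 𝒟} → IsF₂Sum C 𝒟 → ∀ e → does (e ∈? ES C) ≡ F₂.Σₗ (λ D → does (e ∈? ES D)) 𝒟
  char-sum {C} {𝒟} C≡Σ𝒟 e = trans (sym (iff (odd⇔%2 (multiplicity 𝒟 e)))) (sym (parity 𝒟))
    where
    parity : ∀ 𝒟 → F₂.Σₗ (λ D → does (e ∈? ES D)) 𝒟 ≡ odd (multiplicity 𝒟 e)
    parity []      = refl
    parity (D ∷ 𝒟) with does (e ∈? ES D)
    ... | true  = cong not (parity 𝒟)
    ... | false = parity 𝒟
    iff : ∀ {b} → b ≡ true ⇔ multiplicity 𝒟 e % 2 ≡ 1 → b ≡ does (e ∈? ES C)
    iff {true}  h = sym (dec-true (e ∈? ES C) (Equivalence.from (C≡Σ𝒟 e) (Equivalence.to h refl)))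
    iff {false} h = sym (dec-false (e ∈? ES C) λ e∈ →
      contradiction (Equivalence.from h (Equivalence.to (C≡Σ𝒟 e) e∈)) λ ())

  -- The pairing is linear in the chain: the indicator of `ES C` is expanded into those of the
  -- members of `𝒟`.
  ∮-sum : ∀ {C 𝒟} → IsF₂Sum C 𝒟 → ∀ φ → ∮ C φ ≡ F₂.Σₗ (λ D → ∮ D φ) 𝒟
  ∮-sum {C} {𝒟} C≡Σ𝒟 φ = trans
    (F₂.sum-cong-≗ (λ e → trans (cong (if_then φ e else false) (char-sum {C} {𝒟} C≡Σ𝒟 e))
      (if-Σ (λ D → does (e ∈? ES D)) (φ e) 𝒟)))
    (F₂.sum-Σₗ {#E} (λ e D → if does (e ∈? ES D) then φ e else false) 𝒟)
    where
    if-xor : ∀ a b c → (if a xor b then c else false) ≡ (if a then c else false) xor (if b then c else false)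
    if-xor false b     c = refl
    if-xor true  false c = sym (𝔹ₚ.xor-identityʳ c)
    if-xor true  true  c = sym (𝔹ₚ.xor-same c)
    if-Σ : ∀ {A : Set} (b : A → Bool) c xs →
      (if F₂.Σₗ b xs then c else false) ≡ F₂.Σₗ (λ x → if b x then c else false) xs
    if-Σ b c []       = refl
    if-Σ b c (x ∷ xs) = trans (if-xor (b x) (F₂.Σₗ b xs) c) (cong ((if b x then c else false) xor_) (if-Σ b c xs))

  ∮-cong : ∀ {H φ ψ} → (∀ {e} → e ∈ ES H → φ e ≡ ψ e) → ∮ H φ ≡ ∮ H ψ
  ∮-cong {H} {φ} {ψ} φ≡ψ = F₂.sum-cong-≗ pointwise
    where
    pointwise : ∀ e → (if does (e ∈? ES H) then φ e else false) ≡ (if does (e ∈? ES H) then ψ e else false)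
    pointwise e with e ∈? ES H
    ... | yes e∈ = φ≡ψ e∈
    ... | no  _  = refl

  ∮-zero : ∀ {H} → ∮ H (λ _ → false) ≡ false
  ∮-zero {H} = F₂.sum-ε {#E} (λ e → if-same (does (e ∈? ES H)))
    where
    if-same : ∀ b → (if b then false else false) ≡ false
    if-same true  = refl
    if-same false = refl

  ∮-xor : ∀ {H} φ ψ → ∮ H (λ e → φ e xor ψ e) ≡ ∮ H φ xor ∮ H ψ
  ∮-xor {H} φ ψ = trans (F₂.sum-cong-≗ (λ e → if-xor (does (e ∈? ES H)) (φ e) (ψ e))) (F₂.∑-distrib-+ {#E} _ _)
    where
    if-xor : ∀ b c d → (if b then c xor d else false) ≡ (if b then c else false) xor (if b then d else false)
    if-xor true  c d = refl
    if-xor false c d = refl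

  ∮-single : ∀ {H e} φ → e ∈ ES H → ∮ H (λ h → φ h ∧ does (h ≟ e)) ≡ φ e
  ∮-single {H} {e} φ e∈ = trans (F₂.sum-cong-≗ pointwise) (F₂.sum-single φ e)
    where
    pointwise : ∀ h → (if does (h ∈? ES H) then φ h ∧ does (h ≟ e) else false) ≡
      (if does (h ≟ e) then φ h else false)
    pointwise h with h ≟ e
    ... | no  _    = trans (cong (if does (h ∈? ES H) then_else false) (𝔹ₚ.∧-zeroʳ (φ h))) (same (does (h ∈? ES H)))
      where
      same : ∀ b → (if b then false else false) ≡ false
      same true  = refl
      same false = refl
    ... | yes refl rewrite dec-true (h ∈? ES H) e∈ = 𝔹ₚ.∧-identityʳ (φ h)

-- A class of `G - X` met by more than half of `C`.

module Labels (G : Graph) (X : Subset (Graph.#V G)) {m : ℕ} (κ : Graph.V G → Fin m) where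
  open Graph G

  -- `κ` stands in for the map to the components of `G - X`. In the application its values are
  -- branches of the tree, and a class outside `X` is a union of components.
  side : Fin m → V → Bool
  side K v = not (does (v ∈? X)) ∧ does (κ v ≟ K)

  label : Fin m → E → Bool
  label K h = side K (end₁ h) ∨ side K (end₂ h)

  side-true : ∀ {K v} → side K v ≡ true → v ∉ X × κ v ≡ K
  side-true {K} {v} eq with v ∈? X
  ... | no v∉ = v∉ , does-true (κ v ≟ K) eq

  label-true : ∀ {K h} → label K h ≡ true → ∃[ v ] (v ≡ end₁ h ⊎ v ≡ end₂ h) × v ∉ X × κ v ≡ K
  label-true {K} {h} eq with side K (end₁ h) in eq₁
  ... | true  = end₁ h , inj₁ refl , side-true eq₁
  ... | false = end₂ h , inj₂ refl , side-true eq

module Separator (G : Graph) (λG : LengthFunction G)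
  {C : Graph.Subgraph G} (cycleC : Graph.IsCycle G C) (geodesic : LengthFunction.IsGeodesic λG C)
  {𝒟 : List (Graph.Subgraph G)} {ρ : ℚ} (0<ρ : 0ℚ ℚ.< ρ)
  (cycles : ∀ {D} → D ∈ₗ 𝒟 → Graph.IsCycle G D × LengthFunction.len λG D ℚ.≤ ρ)
  (C≡Σ𝒟 : Graph.IsF₂Sum G C 𝒟)
  {k : ℕ} (0<k : 0 ℕ.< k) (len-C : (k ℕ.+ k) ⊛ ρ ≡ LengthFunction.len λG C)
  (X : Subset (Graph.#V G)) (∣X∣≤k : ∣ X ∣ ℕ.≤ k) {m : ℕ} (κ : Graph.V G → Fin m)
  (κ-edge : ∀ e → Graph.end₁ G e ∉ X → Graph.end₂ G e ∉ X → κ (Graph.end₁ G e) ≡ κ (Graph.end₂ G e))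
  where
  open Graph G
  open LengthFunction λG
  open Walks G
  open Lengths G λG
  open F₂Sums G
  open Labels G X κ

  -- Two meeting cycles rather than a common one: `γ` at `v` will be read off from any cycle of `𝒟`
  -- through `v` that meets `X`, and two such cycles share `v`.
  Adj : V → V → Set
  Adj x y = ∃[ D ] D ∈ₗ 𝒟 × ∃[ D′ ] D′ ∈ₗ 𝒟 × x ∈ VS D × y ∈ VS D′ × ∃[ v ] v ∈ VS D × v ∈ VS D′

  Adj? : ∀ x y → Dec (Adj x y)
  Adj? x y = Dec.map′
    (λ a → let (D , D∈ , a′) = find a ; (D′ , D′∈ , r) = find a′ in D , D∈ , D′ , D′∈ , r)
    (λ (D , D∈ , D′ , D′∈ , r) → lose D∈ (lose D′∈ r))
    (Any.any? (λ D → Any.any? (λ D′ → (x ∈? VS D) ×-dec (y ∈? VS D′) ×-dec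
      any? (λ v → (v ∈? VS D) ×-dec (v ∈? VS D′))) 𝒟) 𝒟)

  Adj-sym : ∀ {x y} → Adj x y → Adj y x
  Adj-sym (D , D∈ , D′ , D′∈ , x∈ , y∈ , v , v∈ , v∈′) = D′ , D′∈ , D , D∈ , y∈ , x∈ , v , v∈′ , v∈

  -- On each of the two cycles the shorter arc to the common vertex has length at most half of `ρ`.
  Adj-walk : ∀ {x y} → Adj x y → Σ[ p ∈ Walk x y ] ‖ p ‖ ℚ.≤ ρ
  Adj-walk (D , D∈ , D′ , D′∈ , x∈ , y∈ , v , v∈ , v∈′) =
    let (cD , D≤) = cycles D∈ ; (cD′ , D′≤) = cycles D′∈
        (p , p≤) = half-cycle {D} cD x∈ v∈ ; (q , q≤) = half-cycle {D′} cD′ v∈′ y∈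
    in p ⧺ q , subst (ℚ._≤ ρ) (sym (‖⧺‖ p q)) (mean ‖ p ‖ ‖ q ‖ (ℚₚ.≤-trans p≤ D≤) (ℚₚ.≤-trans q≤ D′≤))
    where
    mean : ∀ s t {r} → s ℚ.+ s ℚ.≤ r → t ℚ.+ t ℚ.≤ r → s ℚ.+ t ℚ.≤ r
    mean s t s≤ t≤ with ℚₚ.≤-total s t
    ... | inj₁ s≤t = ℚₚ.≤-trans (ℚₚ.+-monoˡ-≤ t s≤t) t≤
    ... | inj₂ t≤s = ℚₚ.≤-trans (ℚₚ.+-monoʳ-≤ s t≤s) s≤

  open Tours G λG {C} geodesic X (ℚₚ.<⇒≤ 0<ρ) Adj Adj? Adj-sym Adj-walk using (module Cover; cover)
  open Cover (proj₁ (proj₂ cover)) using (chain; chain⊆; cycle; n; n≤; cost; extend; S⊆X)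

  chain-short : Q.Σₗ ℓ chain ℚ.< len C
  chain-short = subst (Q.Σₗ ℓ chain ℚ.<_) len-C (ℚₚ.≤-<-trans cost (⊛-monoˡ-< 0<ρ n<k+k))
    where
    ∣S∣≤k : ∣ proj₁ cover ∣ ℕ.≤ k
    ∣S∣≤k = ℕₚ.≤-trans (p⊆q⇒∣p∣≤∣q∣ S⊆X) ∣X∣≤k
    n<k+k : n ℕ.< k ℕ.+ k
    -- The chain costs at most `2k - 2` steps, strictly fewer than `2k` because `k` is positive.
    n<k+k = ℕₚ.≤-<-trans (ℕₚ.≤-trans n≤ (ℕₚ.∸-monoˡ-≤ 2 (ℕₚ.+-mono-≤ ∣S∣≤k ∣S∣≤k)))
      (ℕₚ.∸-monoʳ-< {o = 0} (s≤s z≤n) (ℕₚ.+-mono-≤ 0<k 0<k))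

  Uncovered : E → Set
  Uncovered h = h ∈ ES C × ¬ h ∈ₗ chain

  in-some-cycle : ∀ {e} → e ∈ ES C → ∃[ D ] D ∈ₗ 𝒟 × e ∈ ES D
  in-some-cycle {e} e∈ =
    let (D , D∈ , t) = xorSum-true (λ D → does (e ∈? ES D)) 𝒟
                         (trans (sym (char-sum {C} {𝒟} C≡Σ𝒟 e)) (dec-true (e ∈? ES C) e∈))
    in D , D∈ , does-true (e ∈? ES D) t

  module Extension {α β : V → Bool} (β≡α : ∀ {x} → x ∈ X → x ∈ VS C → β x ≡ α x)
    (β-Adj : ∀ {x y} → x ∈ X → y ∈ X → Adj x y → β x ≡ β y) where

    Near : V → Set
    Near v = ∃[ D ] D ∈ₗ 𝒟 × v ∈ VS D × ∃[ y ] y ∈ X × y ∈ VS D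

    near? : ∀ v → Dec (Near v)
    near? v = Dec.map′ find (λ (_ , D∈ , r) → lose D∈ r)
      (Any.any? (λ D → (v ∈? VS D) ×-dec any? (λ y → (y ∈? X) ×-dec (y ∈? VS D))) 𝒟)

    -- `β` is spread from `X` along the cycles of `𝒟` that meet `X`; by `β-Adj` the choice of cycle
    -- and of `y` does not matter. The default `false` is harmless, because on cycles avoiding `X`
    -- the argument works for any labelling.
    γ : V → Bool
    γ v with near? v
    ... | yes (_ , _ , _ , y , _) = β y
    ... | no  _                   = false

    γ≡β : ∀ {D v y} → D ∈ₗ 𝒟 → v ∈ VS D → y ∈ X → y ∈ VS D → γ v ≡ β y
    γ≡β {D} {v} {y} D∈ v∈D y∈X y∈D with near? v
    ... | no  ¬near = contradiction (D , D∈ , v∈D , y , y∈X , y∈D) ¬near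
    ... | yes (D′ , D′∈ , v∈D′ , y′ , y′∈X , y′∈D′) =
      β-Adj y′∈X y∈X (D′ , D′∈ , D , D∈ , y′∈D′ , y∈D , v , v∈D′ , v∈D)

    -- `x` is an end of an edge of `C`, which lies on some cycle of `𝒟`; on that cycle `x` itself is
    -- a vertex of `X`.
    γ≡α : ∀ {x} → x ∈ X → x ∈ VS C → γ x ≡ α x
    γ≡α {x} x∈X x∈C =
      let (e , e∈ , i)  = Cycle.incident {C} cycleC x∈C
          (D , D∈ , e∈D) = in-some-cycle e∈
          (p , q) = Cycle.ends∈ {D} (proj₁ (cycles D∈)) e∈D
          x∈D : _ ∈ VS D
          x∈D = Sum.[ (λ eq → subst (_∈ VS D) eq p) , (λ eq → subst (_∈ VS D) eq q) ]′ i
      in trans (γ≡β D∈ x∈D x∈X x∈D) (β≡α x∈X x∈C)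

    -- The ends lie on one cycle of `𝒟`, hence are adjacent.
    within-X : ∀ {e} → e ∈ ES C → end₁ e ∈ X → end₂ e ∈ X → δ α e ≡ false
    within-X {e} e∈ x∈X y∈X =
      let (D , D∈ , e∈D) = in-some-cycle e∈
          (x∈D , y∈D) = Cycle.ends∈ {D} (proj₁ (cycles D∈)) e∈D
          (x∈C , y∈C) = Cycle.ends∈ {C} cycleC e∈
          αx≡αy = trans (sym (β≡α x∈X x∈C)) (trans
            (β-Adj x∈X y∈X (D , D∈ , D , D∈ , x∈D , y∈D , end₁ e , x∈D , x∈D)) (β≡α y∈X y∈C))
      in trans (cong (_xor α (end₂ e)) αx≡αy) (𝔹ₚ.xor-same (α (end₂ e)))

  side-X : ∀ {K v} → v ∈ X → side K v ≡ false
  side-X {v = v} v∈ rewrite dec-true (v ∈? X) v∈ = refl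

  side-edge : ∀ {K} e → end₁ e ∉ X → end₂ e ∉ X → side K (end₁ e) ≡ side K (end₂ e)
  side-edge e x∉ y∉
    rewrite dec-false (end₁ e ∈? X) x∉ | dec-false (end₂ e ∈? X) y∉ | κ-edge e x∉ y∉ = refl

  module _ (K : Fin m) {α β : V → Bool} (β≡α : ∀ {x} → x ∈ X → x ∈ VS C → β x ≡ α x)
    (β-Adj : ∀ {x y} → x ∈ X → y ∈ X → Adj x y → β x ≡ β y) where
    open Extension β≡α β-Adj

    -- It vanishes on each cycle of `𝒟`. If the cycle meets `X`, then `γ` is constant on it. If not,
    -- `side K` is constant along its edges, and the cochain is there the coboundary of `side K`
    -- times `γ`.
    ∮-label-γ : ∮ C (λ h → label K h ∧ δ γ h) ≡ false
    ∮-label-γ = trans (∮-sum {C} {𝒟} C≡Σ𝒟 _) (F₂.Σₗ-ε 𝒟 on-cycle)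
      where
      on-cycle : ∀ {D} → D ∈ₗ 𝒟 → ∮ D (λ h → label K h ∧ δ γ h) ≡ false
      on-cycle {D} D∈ with any? (λ y → (y ∈? X) ×-dec (y ∈? VS D))
      ... | yes (y , y∈X , y∈D) = trans (∮-cong {D} vanish) (∮-zero {D})
        where
        vanish : ∀ {h} → h ∈ ES D → label K h ∧ δ γ h ≡ false
        vanish {h} h∈ =
          let (u∈ , v∈) = Cycle.ends∈ {D} (proj₁ (cycles D∈)) h∈ in
          trans (cong (label K h ∧_) (trans
            (cong₂ _xor_ (γ≡β D∈ u∈ y∈X y∈D) (γ≡β D∈ v∈ y∈X y∈D)) (𝔹ₚ.xor-same (β y))))
            (𝔹ₚ.∧-zeroʳ (label K h))
      ... | no avoids = trans (∮-cong {D} coboundary) (Cycle.∮δ≡0 {D} (proj₁ (cycles D∈)) (λ v → side K v ∧ γ v))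
        where
        merge : ∀ a x y → (a ∨ a) ∧ (x xor y) ≡ (a ∧ x) xor (a ∧ y)
        merge false x y = refl
        merge true  x y = refl
        coboundary : ∀ {h} → h ∈ ES D → label K h ∧ δ γ h ≡ δ (λ v → side K v ∧ γ v) h
        coboundary {h} h∈
          with Cycle.ends∈ {D} (proj₁ (cycles D∈)) h∈
        ... | u∈ , v∈
          rewrite side-edge {K} h (λ u∈X → avoids (_ , u∈X , u∈)) (λ v∈X → avoids (_ , v∈X , v∈)) =
          merge (side K (end₂ h)) (γ (end₁ h)) (γ (end₂ h))

    -- An edge of `C` leaves `K` only into `X`, where `γ` and `α` agree on `C`. So on `C` the
    -- cochains for `α` and `γ` differ by the coboundary of `ν`, which sums to zero.
    ∮-label-α : ∮ C (λ h → label K h ∧ δ α h) ≡ false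
    ∮-label-α = begin
      ∮ C (λ h → label K h ∧ δ α h)                       ≡⟨ ∮-cong {C} pointwise ⟩
      ∮ C (λ h → (label K h ∧ δ γ h) xor δ ν h)           ≡⟨ ∮-xor {C} (λ h → label K h ∧ δ γ h) (δ ν) ⟩
      ∮ C (λ h → label K h ∧ δ γ h) xor ∮ C (δ ν)         ≡⟨ cong₂ _xor_ ∮-label-γ (Cycle.∮δ≡0 {C} cycleC ν) ⟩
      false                                               ∎
      where
      open ≡-Reasoning
      ν : V → Bool
      ν v = side K v ∧ (γ v xor α v)
      pointwise : ∀ {h} → h ∈ ES C → label K h ∧ δ α h ≡ (label K h ∧ δ γ h) xor δ ν h
      pointwise {h} h∈ = transfer (cases (end₁ h ∈? X) (end₂ h ∈? X))
        where
        cases : Dec (end₁ h ∈ X) → Dec (end₂ h ∈ X) →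
          (side K (end₁ h) ≡ false × γ (end₁ h) ≡ α (end₁ h)) ⊎
          (side K (end₂ h) ≡ false × γ (end₂ h) ≡ α (end₂ h)) ⊎
          side K (end₁ h) ≡ side K (end₂ h)
        cases (yes u∈X) _         = inj₁ (side-X u∈X , γ≡α u∈X (proj₁ (Cycle.ends∈ {C} cycleC h∈)))
        cases (no  _)   (yes v∈X) = inj₂ (inj₁ (side-X v∈X , γ≡α v∈X (proj₂ (Cycle.ends∈ {C} cycleC h∈))))
        cases (no  u∉X) (no  v∉X) = inj₂ (inj₂ (side-edge h u∉X v∉X))

  module _ {e f : E} (e-unc : Uncovered e) (f-unc : Uncovered f) where
    private
      α : V → Bool
      α = proj₁ (cut {C} cycleC (proj₁ e-unc) (proj₁ f-unc))
      δα : ∀ {h} → h ∈ ES C → δ α h ≡ does (h ≟ e) xor does (h ≟ f)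
      δα = proj₂ (cut {C} cycleC (proj₁ e-unc) (proj₁ f-unc))
      δα≡0 : ∀ {h} → h ∈ₗ chain → δ α h ≡ false
      δα≡0 {h} h∈ = trans (δα (chain⊆ h∈)) (cong₂ _xor_
        (dec-false (h ≟ e) λ { refl → proj₂ e-unc h∈ }) (dec-false (h ≟ f) λ { refl → proj₂ f-unc h∈ }))

      β : V → Bool
      β = proj₁ (extend α δα≡0)
      β≡α : ∀ {x} → x ∈ X → x ∈ VS C → β x ≡ α x
      β≡α x∈X x∈C = proj₁ (proj₂ (extend α δα≡0)) (proj₂ (proj₂ cover) x∈X x∈C) x∈C
      β-Adj : ∀ {x y} → x ∈ X → y ∈ X → Adj x y → β x ≡ β y
      β-Adj = proj₂ (proj₂ (extend α δα≡0))

    -- The chain contains neither edge, so the cut `α` through `e` and `f` extends to some `β`, and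
    -- the sum in `∮-label-α` has only the terms of `e` and `f`.
    label-equal : ∀ K → label K e ≡ label K f
    label-equal K = xor≡false⇒≡ (begin
      label K e xor label K f
        ≡⟨ cong₂ _xor_ (∮-single {C} (label K) (proj₁ e-unc)) (∮-single {C} (label K) (proj₁ f-unc)) ⟨
      ∮ C (λ h → label K h ∧ does (h ≟ e)) xor ∮ C (λ h → label K h ∧ does (h ≟ f))
        ≡⟨ ∮-xor {C} (λ h → label K h ∧ does (h ≟ e)) (λ h → label K h ∧ does (h ≟ f)) ⟨
      ∮ C (λ h → (label K h ∧ does (h ≟ e)) xor (label K h ∧ does (h ≟ f)))
        ≡⟨ ∮-cong {C} (λ {h} h∈ → trans (cong (label K h ∧_) (δα h∈)) (𝔹ₚ.∧-distribˡ-xor (label K h) _ _)) ⟨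
      ∮ C (λ h → label K h ∧ δ α h)
        ≡⟨ ∮-label-α K β≡α β-Adj ⟩
      false ∎)
      where open ≡-Reasoning

    -- For distinct edges, `δ α` would be 1 at `e`, contrary to `within-X`.
    within-X⇒≡ : end₁ e ∈ X → end₂ e ∈ X → f ≡ e
    within-X⇒≡ x∈X y∈X with f ≟ e
    ... | yes f≡e = f≡e
    ... | no  f≢e = contradiction (trans (sym (begin
        δ α e                             ≡⟨ δα (proj₁ e-unc) ⟩
        does (e ≟ e) xor does (e ≟ f)     ≡⟨ cong₂ _xor_ (dec-true (e ≟ e) refl) (dec-false (e ≟ f) (f≢e ∘ sym)) ⟩
        true                              ∎)) (Extension.within-X β≡α β-Adj (proj₁ e-unc) x∈X y∈X)) λ ()
      where open ≡-Reasoning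

  W : ℚ
  W = weight (λ h → does (h ∈? ES C) ∧ not (does (h ∈ₗ? chain)))

  uncovered? : ∀ h → Dec (Uncovered h)
  uncovered? h = (h ∈? ES C) ×-dec ¬? (h ∈ₗ? chain)

  len<W+W : len C ℚ.< W ℚ.+ W
  len<W+W = uncovered {C} cycleC chain chain⊆ cycle chain-short

  majority : ∃[ K ] (∃[ v ] v ∉ X × κ v ≡ K) ×
    (let w = weight (λ h → does (h ∈? ES C) ∧ label K h) in len C ℚ.< w ℚ.+ w)
  majority with any? (λ e → uncovered? e ×-dec ¬? ((end₁ e ∈? X) ×-dec (end₂ e ∈? X)))
  -- An end of `e` outside `X` determines the class, and by `label-equal` every uncovered edge meets
  -- it.
  ... | yes (e , e-unc , ¬XX) = κ v , (v , v∉X , refl) ,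
    ℚₚ.<-≤-trans len<W+W (ℚₚ.+-mono-≤ W≤w W≤w)
    where
    outside : ∃[ v ] v ∉ X × (side (κ v) v ≡ true → label (κ v) e ≡ true)
    outside = go (end₁ e ∈? X) (end₂ e ∈? X)
      where
      go : Dec (end₁ e ∈ X) → Dec (end₂ e ∈ X) → ∃[ v ] v ∉ X × (side (κ v) v ≡ true → label (κ v) e ≡ true)
      go (no x∉)  _        = end₁ e , x∉ , cong (_∨ side (κ (end₁ e)) (end₂ e))
      go (yes _)  (no y∉)  = end₂ e , y∉ , λ s →
        trans (cong (side (κ (end₂ e)) (end₁ e) ∨_) s) (𝔹ₚ.∨-zeroʳ (side (κ (end₂ e)) (end₁ e)))
      go (yes x∈) (yes y∈) = contradiction (x∈ , y∈) ¬XX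
    v : V
    v = proj₁ outside
    v∉X : v ∉ X
    v∉X = proj₁ (proj₂ outside)
    label-e : label (κ v) e ≡ true
    label-e = proj₂ (proj₂ outside)
      (cong₂ _∧_ (cong not (dec-false (v ∈? X) v∉X)) (dec-true (κ v ≟ κ v) refl))
    labelled : ∀ h → does (uncovered? h) ≡ true → does (h ∈? ES C) ∧ label (κ v) h ≡ true
    labelled h t = let u = does-true (uncovered? h) t in
      cong₂ _∧_ (dec-true (h ∈? ES C) (proj₁ u)) (trans (label-equal u e-unc (κ v)) label-e)
    W≤w : W ℚ.≤ weight (λ h → does (h ∈? ES C) ∧ label (κ v) h)
    W≤w = weight-mono labelled
  -- All uncovered edges lie within `X`, so there is at most one. Its length is at most `ρ`, which
  -- is no more than half of `C`.
  ... | no none = contradiction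
    (ℚₚ.<-≤-trans len<W+W (ℚₚ.≤-trans (ℚₚ.+-mono-≤ W≤ρ W≤ρ) ρ+ρ≤len)) (ℚₚ.<-irrefl refl)
    where
    only : ∃[ e ] e ∈ ES C × (∀ {h} → Uncovered h → h ≡ e)
    only with any? uncovered?
    -- With no uncovered edge, any edge of `C` serves as a bound.
    ... | no  none′       = Cycle.e₀ {C} cycleC , Cycle.e₀∈ {C} cycleC , λ u → contradiction (_ , u) none′
    ... | yes (e , e-unc) with (end₁ e ∈? X) ×-dec (end₂ e ∈? X)
    ...   | yes (x∈ , y∈) = e , proj₁ e-unc , λ u → within-X⇒≡ e-unc u x∈ y∈
    ...   | no  ¬XX       = contradiction (e , e-unc , ¬XX) none
    e : E
    e = proj₁ only
    W≤ρ : W ℚ.≤ ρ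
    W≤ρ = let (D , D∈ , e∈D) = in-some-cycle (proj₁ (proj₂ only)) in
      ℚₚ.≤-trans (subst (W ℚ.≤_) (weight-single e) (weight-mono {c = λ h → does (h ≟ e)} (λ h t →
        dec-true (h ≟ e) (proj₂ (proj₂ only) (does-true (uncovered? h) t)))))
      (ℚₚ.≤-trans (ℓ≤len D e∈D) (proj₂ (cycles D∈)))
    ρ+ρ≤len : ρ ℚ.+ ρ ℚ.≤ len C
    ρ+ρ≤len = subst₂ ℚ._≤_ (cong (ρ ℚ.+_) (ℚₚ.+-identityʳ ρ)) len-C
      (⊛-monoˡ-≤ {m = 2} (ℚₚ.<⇒≤ 0<ρ) (ℕₚ.+-mono-≤ 0<k 0<k))

-- Branches of a tree.

comprehension : ∀ {n} {P : Fin n → Set} → (∀ i → Dec (P i)) → Subset n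
comprehension P? = tabulate (does ∘ P?)

∈-comprehension⁺ : ∀ {n} {P : Fin n → Set} (P? : ∀ i → Dec (P i)) {i} → P i → i ∈ comprehension P?
∈-comprehension⁺ P? {i} p = lookup⇒[]= i _ (trans (lookup∘tabulate (does ∘ P?) i) (dec-true (P? i) p))

∈-comprehension⁻ : ∀ {n} {P : Fin n → Set} (P? : ∀ i → Dec (P i)) {i} → i ∈ comprehension P? → P i
∈-comprehension⁻ P? {i} i∈ = does-true (P? i) (trans (sym (lookup∘tabulate (does ∘ P?) i)) ([]=⇒lookup i∈))

module Trees (T : Graph) (isTree : Graph.IsTree T) where
  open Graph T
  open Walks T

  connect : ∀ s t → Walk s t
  connect = proj₁ (proj₂ isTree)

  Avoiding : V → V → V → Set
  Avoiding t s s′ = Σ[ p ∈ Walk s s′ ] ¬ t ∈ₗ vertices p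

  Neighbour : V → V → Set
  Neighbour t b = ∃[ e ] Joins e t b

  neighbour-sym : ∀ {t b} → Neighbour t b → Neighbour b t
  neighbour-sym (e , j) = e , Joins-sym j

  neighbour≢ : ∀ {t b} → Neighbour t b → b ≢ t
  neighbour≢ (e , j) refl = Joins-irrefl j

  avoiding-sym : ∀ {t s s′} → Avoiding t s s′ → Avoiding t s′ s
  avoiding-sym (p , t∉) = rev p , t∉ ∘ ∈-vertices-rev p

  avoiding-trans : ∀ {t s s′ s″} → Avoiding t s s′ → Avoiding t s′ s″ → Avoiding t s s″
  avoiding-trans (p , t∉p) (q , t∉q) = p ⧺ q , Sum.[ t∉p , t∉q ]′ ∘ ∈-vertices-⧺ p q

  avoiding-stop : ∀ {t s} → s ≢ t → Avoiding t s s
  avoiding-stop s≢t = [ _ ] , λ { (here refl) → s≢t refl }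

  -- Otherwise the walk, pruned to a path, would close up through `t` to a cycle of the tree.
  neighbours-separated : ∀ {t b b′} → Neighbour t b → Neighbour t b′ → Avoiding t b b′ → b ≡ b′
  neighbours-separated {t} {b} {b′} (e , j) (e′ , j′) (p , t∉p) with b ≟ b′
  ... | yes b≡b′ = b≡b′
  ... | no  b≢b′ = contradiction (C , cycle) (proj₂ (proj₂ isTree))
    where
    q : Walk b b′
    q = proj₁ (toPath p)
    w : Walk t b′
    w = e ∷⟨ j ⟩ q
    t∉q : ¬ t ∈ₗ vertices q
    t∉q t∈ = t∉p (Sublist.lookup (proj₁ (proj₂ (proj₂ (toPath p)))) t∈)
    two : ∀ {x y} (r : Walk x y) → x ≢ y → 2 ℕ.≤ length (vertices r)
    two [ _ ]                  x≢y = contradiction refl x≢y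
    two (_ ∷⟨ _ ⟩ [ _ ])        x≢y = s≤s (s≤s z≤n)
    two (_ ∷⟨ _ ⟩ (_ ∷⟨ _ ⟩ _)) x≢y = s≤s (s≤s z≤n)
    inC : ∀ {f} → f ∈ₗ e′ ∷ edges w → end₁ f ∈ₗ vertices w × end₂ f ∈ₗ vertices w
    inC (here refl) = joins-ends (_∈ₗ vertices w) j′ (source∈ w) (target∈ w)
    inC (there f∈)  = ends∈vertices w f∈
    C : Subgraph
    C = record
      { VS     = fromList (vertices w)
      ; ES     = fromList (e′ ∷ edges w)
      ; closed = λ f∈ → let (x , y) = inC (∈-fromList⁻ _ f∈) in ∈-fromList⁺ x , ∈-fromList⁺ y
      }
    cycle : IsCycle C
    cycle = t , b′ , w , e′ , (¬Any⇒All¬ _ t∉q ∷ proj₁ (proj₂ (toPath p))) , s≤s (two q b≢b′) ,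
      Joins-sym j′ , (λ _ → mk⇔ (∈-fromList⁻ _) ∈-fromList⁺) , (λ _ → mk⇔ (∈-fromList⁻ _) ∈-fromList⁺)

  -- The part of `p` before its first visit to `t` ends in the neighbour `b` that names the branch
  -- containing `s`.
  first-hit : ∀ {s t} (p : Walk s t) → s ≢ t → ∃[ b ] Neighbour t b ×
    Σ[ q ∈ Walk s b ] ¬ t ∈ₗ vertices q × (∀ {x} → x ∈ₗ vertices q → x ∈ₗ vertices p)
  first-hit [ _ ] s≢t = contradiction refl s≢t
  first-hit {s} {t} (_∷⟨_⟩_ {v = v} e j p) s≢t with v ≟ t
  ... | yes refl = s , (e , Joins-sym j) , [ s ] , (λ { (here refl) → s≢t refl }) , λ { (here refl) → here refl }
  ... | no  v≢t  = let (b , nb , q , t∉ , q⊆) = first-hit p v≢t in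
    b , nb , (e ∷⟨ j ⟩ q) , (λ { (here refl) → s≢t refl ; (there t∈) → t∉ t∈ }) ,
    λ { (here refl) → here refl ; (there x∈) → there (q⊆ x∈) }

  -- The neighbour of t in the component of T - t that contains s (and t if s = t).
  branch : V → V → V
  branch t s with s ≟ t
  ... | yes _  = t
  ... | no s≢t = proj₁ (first-hit (connect s t) s≢t)

  branch-spec : ∀ {t s} → s ≢ t → Neighbour t (branch t s) × Avoiding t s (branch t s)
  branch-spec {t} {s} s≢t with s ≟ t
  ... | yes s≡t  = contradiction s≡t s≢t
  ... | no  s≢t′ = let (b , nb , q , t∉ , _) = first-hit (connect s t) s≢t′ in nb , q , t∉

  branch-unique : ∀ {t s b} → s ≢ t → Neighbour t b → Avoiding t s b → branch t s ≡ b
  branch-unique s≢t nb av = let (nb′ , av′) = branch-spec s≢t in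
    neighbours-separated nb′ nb (avoiding-trans (avoiding-sym av′) av)

  branch-avoiding : ∀ {t s s′} → s ≢ t → s′ ≢ t → Avoiding t s s′ → branch t s ≡ branch t s′
  branch-avoiding s≢t s′≢t av = let (nb , av′) = branch-spec s′≢t in
    branch-unique s≢t nb (avoiding-trans av av′)

  -- Some walk from `s` to `t′` avoids `t`. Stopped just before `t′`, it ends in the neighbour of
  -- `t′` on the side of `s`, which would be `t`.
  opposite-branches : ∀ {t t′ s} → s ≢ t → s ≢ t′ → branch t s ≡ t′ → ¬ branch t′ s ≡ t
  opposite-branches {t} {t′} {s} s≢t s≢t′ refl eq =
    let (_ , p , t∉p) = branch-spec s≢t
        (b , nb , q , t′∉q , q⊆p) = first-hit p s≢t′
        b≡t = trans (sym (branch-unique s≢t′ nb (q , t′∉q))) eq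
    in t∉p (q⊆p (subst (_∈ₗ vertices q) b≡t (target∈ q)))

  -- Following next without ever turning back would shrink the branch ahead forever.
  module _ (next : V → V) (next-neighbour : ∀ t → Neighbour t (next t)) where
    private
      Ahead : V → V → Set
      Ahead t s = s ≢ t × branch t s ≡ next t

      ahead? : ∀ t s → Dec (Ahead t s)
      ahead? t s = ¬? (s ≟ t) ×-dec (branch t s ≟ next t)

      ahead : V → Subset #V
      ahead t = comprehension (ahead? t)

      shrinks : ∀ {t} → next (next t) ≢ t → ahead (next t) ⊂ ahead t
      -- The inclusion is strict because `next t` is ahead of `t` but not of itself.
      shrinks {t} no-turn = sub , next t , ∈-comprehension⁺ (ahead? t) next-ahead ,
        λ t′∈ → proj₁ (∈-comprehension⁻ (ahead? (next t)) t′∈) refl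
        where
        t′ = next t
        t′≢t : t′ ≢ t
        t′≢t = neighbour≢ (next-neighbour t)
        next-ahead : Ahead t t′
        next-ahead = t′≢t , branch-unique t′≢t (next-neighbour t) (avoiding-stop t′≢t)
        sub : ahead t′ ⊆ ahead t
        sub {s} s∈ = ∈-comprehension⁺ (ahead? t)
          (s≢t , branch-unique s≢t (next-neighbour t) (avoiding-trans (q , t∉q) last-step))
          where
          s≢t′ = proj₁ (∈-comprehension⁻ (ahead? t′) s∈)
          eq   = proj₂ (∈-comprehension⁻ (ahead? t′) s∈)
          av : Avoiding t′ s (next t′)
          av = subst (Avoiding t′ s) eq (proj₂ (branch-spec s≢t′))
          q    = proj₁ av
          t′∉q = proj₂ av
          t∉q : ¬ t ∈ₗ vertices q
          -- If `q` met `t`, its tail would join the neighbours `t` and `next t′` of `t′` while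
          -- avoiding `t′`. They would then coincide, a turn back.
          t∉q t∈ = let (r , r⊆q , _) = suffix q t∈ in
            no-turn (sym (neighbours-separated (neighbour-sym (next-neighbour t)) (next-neighbour t′)
              (r , λ t′∈r → t′∉q (Sublist.lookup r⊆q t′∈r))))
          s≢t : s ≢ t
          s≢t s≡t = t∉q (subst (_∈ₗ vertices q) s≡t (source∈ q))
          last-step : Avoiding t (next t′) t′
          last-step = let (e , j) = neighbour-sym (next-neighbour t′) in
            (e ∷⟨ j ⟩ [ t′ ]) , λ { (here t≡) → t∉q (subst (_∈ₗ vertices q) (sym t≡) (target∈ q))
                                ; (there (here t≡t′)) → t′≢t (sym t≡t′) }

      descend : (fuel : ℕ) → ∀ t → ∣ ahead t ∣ ℕ.< fuel → ∃[ t ] next (next t) ≡ t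
      descend (ℕ.suc fuel) t (s≤s bound) with next (next t) ≟ t
      ... | yes turn    = t , turn
      ... | no  no-turn = descend fuel (next t) (ℕₚ.<-≤-trans (p⊂q⇒∣p∣<∣q∣ (shrinks no-turn)) bound)

    turning-point : ∃[ t ] next (next t) ≡ t
    turning-point = descend (ℕ.suc ∣ ahead start ∣) start (ℕₚ.n<1+n _)
      where
      some : ∀ n → NonZero n → Fin n
      some (ℕ.suc n) _ = zero
      start : V
      start = some #V (proj₁ isTree)

-- The sides of a bag in a tree-decomposition.

module _ (G : Graph) (D : TreeDecomposition G) where
  open Graph G
  open TreeDecomposition D
  open Trees T isTree

  bag-walk : ∀ {v s s′ t} → v ∈ bag s → v ∈ bag s′ → v ∉ bag t → Avoiding t s s′
  bag-walk {s = s} {s′} {t} v∈s v∈s′ v∉t =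
    let (p , unique , _) = Walks.toPath T (connect s s′) in
    p , λ t∈p → v∉t (coherent p unique t∈p v∈s v∈s′)

  home : V → T.V
  home v = proj₁ (covers-vertices v)

  side-of : T.V → V → T.V
  side-of t v = branch t (home v)

  bag≢ : ∀ {v s t} → v ∈ bag s → v ∉ bag t → s ≢ t
  bag≢ v∈s v∉t refl = v∉t v∈s

  -- Nodes whose bags contain `v` are joined in the tree without passing `t`, so any of them
  -- determines the side of `v`.
  side-of-bag : ∀ {v s t} → v ∉ bag t → v ∈ bag s → side-of t v ≡ branch t s
  side-of-bag {v} v∉t v∈s = let v∈h = proj₂ (covers-vertices v) in
    branch-avoiding (bag≢ v∈h v∉t) (bag≢ v∈s v∉t) (bag-walk v∈h v∈s v∉t)

  side-of-edge : ∀ t e → end₁ e ∉ bag t → end₂ e ∉ bag t → side-of t (end₁ e) ≡ side-of t (end₂ e)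
  side-of-edge t e x∉ y∉ = let (s , x∈ , y∈) = covers-edges e in
    trans (side-of-bag x∉ x∈) (sym (side-of-bag y∉ y∈))

  bag-size : ∀ {k} → 0 ℕ.< k → ¬ k ℕ.≤ width → ∀ t → ∣ bag t ∣ ℕ.≤ k
  bag-size {k} 0<k k≰width t = ℕₚ.≤-trans (≤-max (λ t → ∣ bag t ∣) t)
    -- Despite truncation the largest bag has at most `1 + width` vertices, and `width < k`.
    (ℕₚ.≤-trans (ℕₚ.m≤n+m∸n _ 1) (ℕₚ.≰⇒> k≰width))
    where
    ≤-max : ∀ {n} (f : Fin n → ℕ) i → f i ℕ.≤ Vector.foldr _⊔_ 0 f
    ≤-max f zero    = ℕₚ.m≤m⊔n (f zero) _
    ≤-max f (suc i) = ℕₚ.≤-trans (≤-max (f ∘ suc) i) (ℕₚ.m≤n⊔m (f zero) _)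

-- Majorities at all nodes contradict each other.

module _ (G : Graph) (λG : LengthFunction G)
  {C : Graph.Subgraph G} (cycleC : Graph.IsCycle G C) (geodesic : LengthFunction.IsGeodesic λG C)
  {𝒟 : List (Graph.Subgraph G)} {ρ : ℚ} (0<ρ : 0ℚ ℚ.< ρ)
  (cycles : ∀ {D} → D ∈ₗ 𝒟 → Graph.IsCycle G D × LengthFunction.len λG D ℚ.≤ ρ)
  (C≡Σ𝒟 : Graph.IsF₂Sum G C 𝒟)
  {k : ℕ} (0<k : 0 ℕ.< k) (len-C : (k ℕ.+ k) ⊛ ρ ≡ LengthFunction.len λG C)
  where
  open Graph G
  open LengthFunction λG
  open Lengths G λG

  -- Disjoint parts of `C` cannot both exceed half of its length.
  majorities-meet : (b c : E → Bool) →
    (let v = weight (λ h → does (h ∈? ES C) ∧ b h) ; w = weight (λ h → does (h ∈? ES C) ∧ c h) in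
    len C ℚ.< v ℚ.+ v → len C ℚ.< w ℚ.+ w → ∃[ h ] b h ≡ true × c h ≡ true)
  majorities-meet b c L<v+v L<w+w with any? (λ h → (b h 𝔹ₚ.≟ true) ×-dec (c h 𝔹ₚ.≟ true))
  ... | yes common = common
  ... | no  none   = contradiction (begin-strict
    len C ℚ.+ len C              <⟨ ℚₚ.+-mono-< L<v+v L<w+w ⟩
    (v ℚ.+ v) ℚ.+ (w ℚ.+ w)      ≡⟨ +-interchange v v w w ⟩
    (v ℚ.+ w) ℚ.+ (v ℚ.+ w)      ≤⟨ ℚₚ.+-mono-≤ v+w≤L v+w≤L ⟩
    len C ℚ.+ len C              ∎) (ℚₚ.<-irrefl refl)
    where
    open ℚₚ.≤-Reasoning
    v w : ℚ
    v = weight (λ h → does (h ∈? ES C) ∧ b h)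
    w = weight (λ h → does (h ∈? ES C) ∧ c h)
    disjoint-≤ : ∀ a x y {z} → 0ℚ ℚ.≤ z → ¬ (x ≡ true × y ≡ true) →
      (if a ∧ x then z else 0ℚ) ℚ.+ (if a ∧ y then z else 0ℚ) ℚ.≤ (if a then z else 0ℚ)
    disjoint-≤ false x     y     0≤z ¬xy = ℚₚ.≤-refl
    disjoint-≤ true  false false 0≤z ¬xy = 0≤z
    disjoint-≤ true  false true  0≤z ¬xy = ℚₚ.≤-reflexive (ℚₚ.+-identityˡ _)
    disjoint-≤ true  true  false 0≤z ¬xy = ℚₚ.≤-reflexive (ℚₚ.+-identityʳ _)
    disjoint-≤ true  true  true  0≤z ¬xy = contradiction (refl , refl) ¬xy
    v+w≤L : v ℚ.+ w ℚ.≤ len C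
    v+w≤L = subst (ℚ._≤ len C) (Q.∑-distrib-+ {#E} _ _)
      (sum-mono-≤ (λ h → disjoint-≤ (does (h ∈? ES C)) (b h) (c h) (0≤ℓ h) (λ bc → none (h , bc))))

  -- The vertex `v` outside the bag ensures that `K` is a neighbour of `t`, and not the value `t`
  -- that `branch` takes at `t` itself.
  Majority : (D : TreeDecomposition G) → TreeDecomposition.T.V D → Set
  Majority D t = ∃[ K ] (∃[ v ] v ∉ bag t × side-of G D t v ≡ K) ×
      (let w = weight (λ h → does (h ∈? ES C) ∧ label K h) in len C ℚ.< w ℚ.+ w)
    where
    open TreeDecomposition D
    open Labels G (bag t) (side-of G D t)

  -- At a turning point `t` some edge `h` belongs to the majorities of both `t` and `next t`. A node
  -- whose bag contains `h` would then lie beyond `next t` as seen from `t`, and beyond `t` as seen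
  -- from `next t`.
  no-majorities : (D : TreeDecomposition G) → ¬ (∀ t → Majority D t)
  no-majorities D majority =
    let (t , turn)         = turning-point next next-neighbour
        (_ , _ , large)    = majority t
        (_ , _ , large′)   = majority (next t)
        (h , lab , lab′)   = majorities-meet _ _ large large′
        (u , u-end , u∉ , u-side) = Labels.label-true G (bag t) (side-of G D t) {h = h} lab
        (v , v-end , v∉ , v-side) = Labels.label-true G (bag (next t)) (side-of G D (next t)) {h = h} lab′
        (s , h₁∈ , h₂∈)    = covers-edges h
        u∈ = in-bag h₁∈ h₂∈ u-end
        v∈ = in-bag h₁∈ h₂∈ v-end
    in opposite-branches (bag≢ G D u∈ u∉) (bag≢ G D v∈ v∉)
         (trans (sym (side-of-bag G D u∉ u∈)) u-side)
         (trans (sym (side-of-bag G D v∉ v∈)) (trans v-side turn))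
    where
    open TreeDecomposition D
    open Trees T isTree
    next : T.V → T.V
    next t = proj₁ (majority t)
    next-neighbour : ∀ t → Neighbour t (next t)
    next-neighbour t = let (_ , (v , v∉ , v-side) , _) = majority t in
      subst (Neighbour t) v-side (proj₁ (branch-spec {s = home G D v} (bag≢ G D (proj₂ (covers-vertices v)) v∉)))
    in-bag : ∀ {s x y v} → x ∈ bag s → y ∈ bag s → v ≡ x ⊎ v ≡ y → v ∈ bag s
    in-bag x∈ y∈ (inj₁ refl) = x∈
    in-bag x∈ y∈ (inj₂ refl) = y∈

  treewidth≥ : TreeWidth≥ G k
  treewidth≥ D with k ℕₚ.≤? TreeDecomposition.width D
  ... | yes k≤ = k≤
  ... | no  k≰ = contradiction (λ t → Separator.majority G λG {C} cycleC geodesic 0<ρ cycles C≡Σ𝒟 0<k len-C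
      (TreeDecomposition.bag D t) (bag-size G D 0<k k≰ t) (side-of G D t) (side-of-edge G D t))
    (no-majorities D)

-- From the real bound to a rational one.

⊛≡* : ∀ n p → n ⊛ p ≡ (+ n ℚ./ 1) ℚ.* p
⊛≡* ℕ.zero    p = sym (ℚₚ.*-zeroˡ p)
⊛≡* (ℕ.suc n) p = begin
  p ℚ.+ n ⊛ p                               ≡⟨ cong₂ ℚ._+_ (sym (ℚₚ.*-identityˡ p)) (⊛≡* n p) ⟩
  1ℚ ℚ.* p ℚ.+ (+ n ℚ./ 1) ℚ.* p            ≡⟨ ℚₚ.*-distribʳ-+ p 1ℚ (+ n ℚ./ 1) ⟨
  (1ℚ ℚ.+ (+ n ℚ./ 1)) ℚ.* p                ≡⟨ cong (ℚ._* p) 1+n ⟩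
  (+ ℕ.suc n ℚ./ 1) ℚ.* p                   ∎
  where
  open ≡-Reasoning
  1+n : 1ℚ ℚ.+ (+ n ℚ./ 1) ≡ + ℕ.suc n ℚ./ 1
  1+n = ℚₚ.toℚᵘ-injective (ℚᵘₚ.≃-trans (ℚₚ.toℚᵘ-homo-+ 1ℚ (+ n ℚ./ 1))
    (ℚᵘₚ.≃-trans (ℚᵘₚ.+-congʳ (ℚ.toℚᵘ 1ℚ) (ℚₚ.toℚᵘ-fromℚᵘ (mkℚᵘ (+ n) 0)))
    (ℚᵘₚ.≃-trans (*≡* {q = mkℚᵘ (+ ℕ.suc n) 0} (cong (λ i → (+ 1 ℤ.+ i) ℤ.* + 1) (ℤₚ.*-identityʳ (+ n))))
      (ℚᵘₚ.≃-sym (ℚₚ.toℚᵘ-fromℚᵘ (mkℚᵘ (+ ℕ.suc n) 0))))))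

-- share = L / 2k takes the place of the real number r.
module _ (k : ℕ) .{{_ : NonZero k}} (L : ℚ) where
  private
    c : ℚ
    c = + k ℚ./ 1
    instance
      c-pos : ℚ.Positive c
      c-pos = ℚₚ.normalize-pos k 1
      c-nonZero : ℚ.NonZero c
      c-nonZero = ℚₚ.pos⇒nonZero c
      c⁻¹-pos : ℚ.Positive (1/ c)
      c⁻¹-pos = ℚₚ.1/pos⇒pos c

  share : ℚ
  share = (L ℚ.* ½) ℚ.* 1/ c

  share-positive : 0ℚ ℚ.< L → 0ℚ ℚ.< share
  share-positive 0<L = subst (ℚ._< share) (trans (cong (ℚ._* 1/ c) (ℚₚ.*-zeroˡ ½)) (ℚₚ.*-zeroˡ (1/ c)))
    (ℚₚ.*-monoˡ-<-pos (1/ c) (ℚₚ.*-monoˡ-<-pos ½ 0<L))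

  share-total : (k ℕ.+ k) ⊛ share ≡ L
  share-total = begin
    (k ℕ.+ k) ⊛ share                  ≡⟨ ×-homo-+ share k k ⟩
    k ⊛ share ℚ.+ k ⊛ share            ≡⟨ cong (λ x → x ℚ.+ x) half ⟩
    L ℚ.* ½ ℚ.+ L ℚ.* ½                ≡⟨ ℚₚ.*-distribˡ-+ L ½ ½ ⟨
    L ℚ.* 1ℚ                           ≡⟨ ℚₚ.*-identityʳ L ⟩
    L                                  ∎
    where
    open ≡-Reasoning
    half : k ⊛ share ≡ L ℚ.* ½
    half = begin
      k ⊛ share                        ≡⟨ ⊛≡* k share ⟩
      c ℚ.* share                      ≡⟨ ℚₚ.*-comm c share ⟩
      (L ℚ.* ½) ℚ.* 1/ c ℚ.* c         ≡⟨ ℚₚ.*-assoc (L ℚ.* ½) (1/ c) c ⟩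
      (L ℚ.* ½) ℚ.* (1/ c ℚ.* c)       ≡⟨ cong ((L ℚ.* ½) ℚ.*_) (ℚₚ.*-inverseˡ c) ⟩
      (L ℚ.* ½) ℚ.* 1ℚ                 ≡⟨ ℚₚ.*-identityʳ (L ℚ.* ½) ⟩
      L ℚ.* ½                          ∎

  ≤-share : (r : ℝ) → 2 · k · r ≤ᵣ fromℚ L → ∀ {x} → fromℚ x ≤ᵣ r → x ℚ.≤ share
  -- By the order of factors in `share`, `ℝ.L r share` unfolds to `ℝ.L (2 · k · r) L`. So
  -- `share < x` would give `L < L`.
  ≤-share r 2kr≤L x≤r = ℚₚ.≮⇒≥ λ share<x → ℚₚ.<-irrefl refl (2kr≤L (x≤r share<x))

theorem1 : (k : ℕ) .{{_ : NonZero k}} (r : ℝ) → Positiveᵣ r →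
    (G : Graph) (λG : LengthFunction G) →
    let open Graph G
        open LengthFunction λG
    in
    (C : Subgraph) → IsCycle C → IsGeodesic C →
    2 · k · r ≤ᵣ fromℚ (len C) →
    (𝒟 : List Subgraph) → Unique 𝒟 →
    All (λ D → IsCycle D × fromℚ (len D) ≤ᵣ r) 𝒟 →
    IsF₂Sum C 𝒟 →
    TreeWidth≥ G k
theorem1 k r _ G λG C cycleC geodesic 2kr≤ 𝒟 _ short C≡Σ𝒟 =
  treewidth≥ G λG {C} cycleC geodesic (share-positive k (len C) 0<len)
    (λ D∈ → let (cD , D≤r) = All.lookup short D∈ in cD , ≤-share k (len C) r 2kr≤ D≤r)
    C≡Σ𝒟 (ℕₚ.n≢0⇒n>0 (ℕ.≢-nonZero⁻¹ k)) (share-total k (len C))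
  where
  open Graph G
  open LengthFunction λG
  0<len : 0ℚ ℚ.< len C
  0<len = let open Walks.Cycle G {C} cycleC in
    ℚₚ.<-≤-trans (ℓ-positive e₀) (Lengths.ℓ≤len G λG C e₀∈)
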